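{- Let $\mu_m=\dfrac{(aq;q)_m}{(abq^2;q)_m}$ for integers $m\ge 0$. Let $n$ be a positive integer and $t$ a nonnegative integer. Then $$\det\left(\mu_{i+j+t}\right)_{0\le i,j\le n-1}=a^{\frac12 n(n-1)}\,q^{\frac16 n(n-1)(2n-1)+\frac12 n(n-1)t}\left\{\frac{(aq;q)_t}{(abq^2;q)_t}\right\}^{n}\prod_{k=1}^{n}\frac{(q;q)_{n-k}\,(aq^{t+1};q)_{n-k}\,(bq;q)_{n-k}}{(abq^{n-k+t+1};q)_{n-k}\,(abq^{t+2};q)_{2(n-k)}}.$$
   Context: Here $a,b,q$ are indeterminates, and the identity is an identity of rational functions in $a,b,q$. For a nonnegative integer $m$, the $q$-shifted factorial is $(x;q)_m=\prod_{k=0}^{m-1}(1-xq^k)$, with $(x;q)_0=1$. -}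

module Defs where

open import Algebra.Bundles using (CommutativeRing)
open import Algebra.Definitions using (Congruent₁; Congruent₂)
import Algebra.Properties.CommutativeMonoid.Sum as MonoidSum
import Algebra.Properties.Ring as RingProperties
import Algebra.Properties.Semiring.Exp as SemiringExp
import Algebra.Solver.Ring.NaturalCoefficients.Default as NaturalCoefficients
open import Data.Empty using (⊥-elim)
open import Data.Fin.Base using (Fin; zero; suc; toℕ; punchIn)
open import Data.List.Base using (List; []; _∷_; map)
open import Data.Nat.Base as ℕ using (ℕ; zero; suc)
open import Data.Product.Base using (_,_)
import Data.Rational.Properties as ℚ
open import Data.Sum.Base using (_⊎_; inj₁; inj₂; [_,_]′)
open import Function.Base using (_∘_)
open import Level using (Level; _⊔_; 0ℓ) renaming (suc to lsuc)
open import Relation.Binary.Definitions using (Decidable)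
import Relation.Binary.Reasoning.Setoid as SetoidReasoning
open import Relation.Binary.PropositionalEquality.Core as ≡ using (_≡_)
open import Relation.Nullary using (¬_; Dec; yes; no)

private
  variable
    c ℓ : Level

module RingNotions (R : CommutativeRing c ℓ) where
  open CommutativeRing R hiding (zero)
  open MonoidSum +-commutativeMonoid using (sum)
  open MonoidSum *-commutativeMonoid using () renaming (sum to product)
  open SemiringExp semiring using (_^_)

  Matrix : ℕ → Set c
  Matrix n = Fin n → Fin n → Carrier

  -- Laplace expansion along row 0; `punchIn j` skips column j.
  det : ∀ {n} → Matrix n → Carrier
  det {zero}  A = 1#
  det {suc n} A = sum λ j →
    ((- 1#) ^ toℕ j * A zero j) * det (λ i k → A (suc i) (punchIn j k))

  -- ∏[1≤k≤ n ] f  is  f 1 * ⋯ * f n.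
  ∏[1≤k≤_] : (n : ℕ) → (ℕ → Carrier) → Carrier
  ∏[1≤k≤ n ] f = product {n} λ i → f (suc (toℕ i))

  -- ⟨ x ⨾ q ⟩ m  is  (x;q)ₘ.
  ⟨_⨾_⟩_ : Carrier → Carrier → ℕ → Carrier
  ⟨ x ⨾ q ⟩ m = product {m} λ k → 1# - x * q ^ toℕ k

record DiscreteDomain c ℓ : Set (lsuc (c ⊔ ℓ)) where
  field
    commutativeRing : CommutativeRing c ℓ
  open CommutativeRing commutativeRing public hiding (zero)
  field
    _≟_             : Decidable _≈_
    1≉0             : ¬ 1# ≈ 0#
    noZeroDivisors  : ∀ x y → x * y ≈ 0# → x ≈ 0# ⊎ y ≈ 0#

ℚ-domain : DiscreteDomain 0ℓ 0ℓ
ℚ-domain = record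
  { commutativeRing = ℚ.+-*-commutativeRing
  ; _≟_             = ℚ._≟_
  ; 1≉0             = λ ()
  ; noZeroDivisors  = nzd
  }
  where
  open CommutativeRing ℚ.+-*-commutativeRing
  nzd : ∀ x y → x * y ≈ 0# → x ≈ 0# ⊎ y ≈ 0#
  nzd x y xy≈0 with x ℚ.≟ 0#
  ... | yes x≈0 = inj₁ x≈0
  ... | no  x≉0 = inj₂ (begin
    y                  ≈⟨ *-identityˡ y ⟨
    1# * y             ≈⟨ *-congʳ (ℚ.*-inverseˡ x) ⟨
    (1/x * x) * y      ≈⟨ *-assoc 1/x x y ⟩
    1/x * (x * y)      ≈⟨ *-congˡ {1/x} xy≈0 ⟩
    1/x * 0#           ≈⟨ zeroʳ 1/x ⟩
    0#                 ∎)
    where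
    open SetoidReasoning setoid
    open import Data.Rational.Base using (1/_; NonZero; ≢-nonZero)
    instance
      _ : NonZero x
      _ = ≢-nonZero x≉0
    1/x = 1/ x

private
  module RingIdentities (R : CommutativeRing c ℓ) where
    open CommutativeRing R
    open NaturalCoefficients commutativeSemiring using (solve; _:=_; _:+_; _:*_)

    swap : ∀ x y z → x + (y + z) ≈ y + (x + z)
    swap = solve 3 (λ x y z →
      x :+ (y :+ z) := y :+ (x :+ z)) refl

    interchange : ∀ x y z u v → x * (y + z) + (u + v) ≈ (x * y + u) + (x * z + v)
    interchange = solve 5 (λ x y z u v →
      x :* (y :+ z) :+ (u :+ v) := (x :* y :+ u) :+ (x :* z :+ v)) refl

    s1 : ∀ x y z → x * y * z ≈ x * z * y
    s1 = solve 3 (λ x y z →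
      x :* y :* z := x :* z :* y) refl
    s2 : ∀ m₁ d₁ m₂ d₂ e₁ e₂ →
      (m₁ * d₂ + m₂ * d₁) * (e₁ * e₂) ≈ (m₁ * e₁) * (d₂ * e₂) + (m₂ * e₂) * (d₁ * e₁)
    s2 = solve 6 (λ m₁ d₁ m₂ d₂ e₁ e₂ →
      (m₁ :* d₂ :+ m₂ :* d₁) :* (e₁ :* e₂) := (m₁ :* e₁) :* (d₂ :* e₂) :+ (m₂ :* e₂) :* (d₁ :* e₁)) refl
    s3 : ∀ n₁ d₁ n₂ d₂ e₁ e₂ →
      (n₁ * d₁) * (d₂ * e₂) + (n₂ * d₂) * (d₁ * e₁) ≈ (n₁ * e₂ + n₂ * e₁) * (d₁ * d₂)
    s3 = solve 6 (λ n₁ d₁ n₂ d₂ e₁ e₂ →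
      (n₁ :* d₁) :* (d₂ :* e₂) :+ (n₂ :* d₂) :* (d₁ :* e₁) := (n₁ :* e₂ :+ n₂ :* e₁) :* (d₁ :* d₂)) refl
    s4 : ∀ m n d e → (m * n) * (d * e) ≈ (m * d) * (n * e)
    s4 = solve 4 (λ m n d e →
      (m :* n) :* (d :* e) := (m :* d) :* (n :* e)) refl
    s5 : ∀ m d n e o f →
      ((m * e + n * d) * f + o * (d * e)) * (d * (e * f)) ≈
      (m * (e * f) + (n * f + o * e) * d) * (d * e * f)
    s5 = solve 6 (λ m d n e o f →
      ((m :* e :+ n :* d) :* f :+ o :* (d :* e)) :* (d :* (e :* f)) := (m :* (e :* f) :+ (n :* f :+ o :* e) :* d) :* (d :* e :* f)) refl
    s6 : ∀ m d n e → (m * e + n * d) * (e * d) ≈ (n * d + m * e) * (d * e)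
    s6 = solve 4 (λ m d n e →
      (m :* e :+ n :* d) :* (e :* d) := (n :* d :+ m :* e) :* (d :* e)) refl
    s7 : ∀ m n o d e f → (m * n * o) * (d * (e * f)) ≈ (m * (n * o)) * (d * e * f)
    s7 = solve 6 (λ m n o d e f →
      (m :* n :* o) :* (d :* (e :* f)) := (m :* (n :* o)) :* (d :* e :* f)) refl
    s8 : ∀ m n d e → (m * n) * (e * d) ≈ (n * m) * (d * e)
    s8 = solve 4 (λ m n d e →
      (m :* n) :* (e :* d) := (n :* m) :* (d :* e)) refl
    s9 : ∀ m d n e o f →
      (m * (n * f + o * e)) * (d * e * (d * f)) ≈
      (m * n * (d * f) + m * o * (d * e)) * (d * (e * f))
    s9 = solve 6 (λ m d n e o f →
      (m :* (n :* f :+ o :* e)) :* (d :* e :* (d :* f)) := (m :* n :* (d :* f) :+ m :* o :* (d :* e)) :* (d :* (e :* f))) refl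

-- Univariate polynomials: coefficient lists, lowest degree first, with
-- trailing zeros identified away by the equality.

module Polynomial (D : DiscreteDomain c ℓ) where
  open DiscreteDomain D
  open RingProperties ring using (-0#≈0#)
  open SetoidReasoning setoid

  private
    module I = RingIdentities commutativeRing

  Poly : Set c
  Poly = List Carrier

  coeff : Poly → ℕ → Carrier
  coeff []      i       = 0#
  coeff (x ∷ p) zero    = x
  coeff (x ∷ p) (suc i) = coeff p i

  infix 4 _≈ₚ_
  record _≈ₚ_ (p q : Poly) : Set ℓ where
    constructor mk
    field at : ∀ i → coeff p i ≈ coeff q i
  open _≈ₚ_ public

  infixl 6 _+ₚ_
  infixl 7 _*ₚ_ _·_
  infix  8 -ₚ_

  _+ₚ_ : Poly → Poly → Poly
  []      +ₚ q       = q
  (x ∷ p) +ₚ []      = x ∷ p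
  (x ∷ p) +ₚ (y ∷ q) = (x + y) ∷ (p +ₚ q)

  -ₚ_ : Poly → Poly
  -ₚ_ = map (-_)

  _·_ : Carrier → Poly → Poly
  x · p = map (x *_) p

  _*ₚ_ : Poly → Poly → Poly
  []      *ₚ q = []
  (x ∷ p) *ₚ q = x · q +ₚ (0# ∷ (p *ₚ q))

  const : Carrier → Poly
  const x = x ∷ []

  X : Poly
  X = 0# ∷ 1# ∷ []

  coeff-+ : ∀ p q i → coeff (p +ₚ q) i ≈ coeff p i + coeff q i
  coeff-+ []      q       i       = sym (+-identityˡ _)
  coeff-+ (x ∷ p) []      i       = sym (+-identityʳ _)
  coeff-+ (x ∷ p) (y ∷ q) zero    = refl
  coeff-+ (x ∷ p) (y ∷ q) (suc i) = coeff-+ p q i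

  coeff-neg : ∀ p i → coeff (-ₚ p) i ≈ - coeff p i
  coeff-neg []      i       = sym -0#≈0#
  coeff-neg (x ∷ p) zero    = refl
  coeff-neg (x ∷ p) (suc i) = coeff-neg p i

  coeff-· : ∀ x p i → coeff (x · p) i ≈ x * coeff p i
  coeff-· x []      i       = sym (zeroʳ x)
  coeff-· x (y ∷ p) zero    = refl
  coeff-· x (y ∷ p) (suc i) = coeff-· x p i

  coeff-*-zero : ∀ x p q → coeff ((x ∷ p) *ₚ q) 0 ≈ x * coeff q 0
  coeff-*-zero x p q = begin
    coeff ((x ∷ p) *ₚ q) 0 ≈⟨ coeff-+ (x · q) _ 0 ⟩
    coeff (x · q) 0 + 0#   ≈⟨ +-identityʳ _ ⟩
    coeff (x · q) 0        ≈⟨ coeff-· x q 0 ⟩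
    x * coeff q 0          ∎

  coeff-*-suc : ∀ x p q i →
    coeff ((x ∷ p) *ₚ q) (suc i) ≈ x * coeff q (suc i) + coeff (p *ₚ q) i
  coeff-*-suc x p q i = begin
    coeff ((x ∷ p) *ₚ q) (suc i)               ≈⟨ coeff-+ (x · q) _ (suc i) ⟩
    coeff (x · q) (suc i) + coeff (p *ₚ q) i   ≈⟨ +-congʳ (coeff-· x q (suc i)) ⟩
    x * coeff q (suc i) + coeff (p *ₚ q) i     ∎

  coeff₀-* : ∀ p q → coeff (p *ₚ q) 0 ≈ coeff p 0 * coeff q 0
  coeff₀-* []      q = sym (zeroˡ _)
  coeff₀-* (x ∷ p) q = coeff-*-zero x p q

  ≈ₚ-refl : ∀ {p} → p ≈ₚ p
  ≈ₚ-refl = mk λ _ → refl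

  ≈ₚ-sym : ∀ {p q} → p ≈ₚ q → q ≈ₚ p
  ≈ₚ-sym e = mk λ i → sym (at e i)

  ≈ₚ-trans : ∀ {p q r} → p ≈ₚ q → q ≈ₚ r → p ≈ₚ r
  ≈ₚ-trans e f = mk λ i → trans (at e i) (at f i)

  +ₚ-cong : Congruent₂ _≈ₚ_ _+ₚ_
  +ₚ-cong {p} {p′} {q} {q′} e f = mk λ i → begin
    coeff (p +ₚ q) i        ≈⟨ coeff-+ p q i ⟩
    coeff p i + coeff q i   ≈⟨ +-cong (at e i) (at f i) ⟩
    coeff p′ i + coeff q′ i ≈⟨ coeff-+ p′ q′ i ⟨
    coeff (p′ +ₚ q′) i      ∎

  -ₚ-cong : Congruent₁ _≈ₚ_ -ₚ_
  -ₚ-cong {p} {q} e = mk λ i →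
    trans (coeff-neg p i) (trans (-‿cong (at e i)) (sym (coeff-neg q i)))

  +ₚ-assoc : ∀ p q r → (p +ₚ q) +ₚ r ≈ₚ p +ₚ (q +ₚ r)
  +ₚ-assoc p q r = mk λ i → begin
    coeff ((p +ₚ q) +ₚ r) i                 ≈⟨ coeff-+ (p +ₚ q) r i ⟩
    coeff (p +ₚ q) i + coeff r i            ≈⟨ +-congʳ (coeff-+ p q i) ⟩
    coeff p i + coeff q i + coeff r i       ≈⟨ +-assoc _ _ _ ⟩
    coeff p i + (coeff q i + coeff r i)     ≈⟨ +-congˡ (coeff-+ q r i) ⟨
    coeff p i + coeff (q +ₚ r) i            ≈⟨ coeff-+ p (q +ₚ r) i ⟨
    coeff (p +ₚ (q +ₚ r)) i                 ∎

  +ₚ-comm : ∀ p q → p +ₚ q ≈ₚ q +ₚ p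
  +ₚ-comm p q = mk λ i →
    trans (coeff-+ p q i) (trans (+-comm _ _) (sym (coeff-+ q p i)))

  +ₚ-identityˡ : ∀ p → [] +ₚ p ≈ₚ p
  +ₚ-identityˡ p = ≈ₚ-refl

  +ₚ-identityʳ : ∀ p → p +ₚ [] ≈ₚ p
  +ₚ-identityʳ p = +ₚ-comm p []

  -ₚ-inverseˡ : ∀ p → -ₚ p +ₚ p ≈ₚ []
  -ₚ-inverseˡ p = mk λ i → begin
    coeff (-ₚ p +ₚ p) i         ≈⟨ coeff-+ (-ₚ p) p i ⟩
    coeff (-ₚ p) i + coeff p i  ≈⟨ +-congʳ (coeff-neg p i) ⟩
    - coeff p i + coeff p i     ≈⟨ -‿inverseˡ _ ⟩
    0#                          ∎

  -ₚ-inverseʳ : ∀ p → p +ₚ -ₚ p ≈ₚ []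
  -ₚ-inverseʳ p = ≈ₚ-trans (+ₚ-comm p (-ₚ p)) (-ₚ-inverseˡ p)

  *ₚ-[] : ∀ p → p *ₚ [] ≈ₚ []
  *ₚ-[] []      = ≈ₚ-refl
  *ₚ-[] (x ∷ p) = mk λ
    { zero    → refl
    ; (suc i) → at (*ₚ-[] p) i
    }

  coeff-*-∷ʳ-zero : ∀ p y q → coeff (p *ₚ (y ∷ q)) 0 ≈ y * coeff p 0
  coeff-*-∷ʳ-zero p y q = trans (coeff₀-* p (y ∷ q)) (*-comm _ _)

  coeff-*-∷ʳ-suc : ∀ p y q i →
    coeff (p *ₚ (y ∷ q)) (suc i) ≈ y * coeff p (suc i) + coeff (p *ₚ q) i
  coeff-*-∷ʳ-suc []      y q i       = sym (trans (+-identityʳ _) (zeroʳ y))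
  coeff-*-∷ʳ-suc (x ∷ p) y q zero    = begin
    coeff ((x ∷ p) *ₚ (y ∷ q)) 1                ≈⟨ coeff-*-suc x p (y ∷ q) 0 ⟩
    x * coeff q 0 + coeff (p *ₚ (y ∷ q)) 0      ≈⟨ +-comm _ _ ⟩
    coeff (p *ₚ (y ∷ q)) 0 + x * coeff q 0      ≈⟨ +-cong (coeff-*-∷ʳ-zero p y q)
                                                          (sym (coeff-*-zero x p q)) ⟩
    y * coeff p 0 + coeff ((x ∷ p) *ₚ q) 0      ∎
  coeff-*-∷ʳ-suc (x ∷ p) y q (suc i) = begin
    coeff ((x ∷ p) *ₚ (y ∷ q)) (suc (suc i))
      ≈⟨ coeff-*-suc x p (y ∷ q) (suc i) ⟩
    x * coeff q (suc i) + coeff (p *ₚ (y ∷ q)) (suc i)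
      ≈⟨ +-congˡ (coeff-*-∷ʳ-suc p y q i) ⟩
    x * coeff q (suc i) + (y * coeff p (suc i) + coeff (p *ₚ q) i)
      ≈⟨ I.swap _ _ _ ⟩
    y * coeff p (suc i) + (x * coeff q (suc i) + coeff (p *ₚ q) i)
      ≈⟨ +-congˡ (coeff-*-suc x p q i) ⟨
    y * coeff p (suc i) + coeff ((x ∷ p) *ₚ q) (suc i) ∎

  *ₚ-comm : ∀ p q → p *ₚ q ≈ₚ q *ₚ p
  *ₚ-comm []      q = ≈ₚ-sym (*ₚ-[] q)
  *ₚ-comm (x ∷ p) q = mk λ
    { zero    → trans (coeff-*-zero x p q) (sym (coeff-*-∷ʳ-zero q x p))
    ; (suc i) → begin
        coeff ((x ∷ p) *ₚ q) (suc i)              ≈⟨ coeff-*-suc x p q i ⟩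
        x * coeff q (suc i) + coeff (p *ₚ q) i    ≈⟨ +-congˡ (at (*ₚ-comm p q) i) ⟩
        x * coeff q (suc i) + coeff (q *ₚ p) i    ≈⟨ coeff-*-∷ʳ-suc q x p i ⟨
        coeff (q *ₚ (x ∷ p)) (suc i)              ∎
    }

  *ₚ-congˡ : ∀ p {q r} → q ≈ₚ r → p *ₚ q ≈ₚ p *ₚ r
  *ₚ-congˡ []      e         = ≈ₚ-refl
  *ₚ-congˡ (x ∷ p) {q} {r} e = mk λ
    { zero    → trans (coeff-*-zero x p q)
                  (trans (*-congˡ (at e 0)) (sym (coeff-*-zero x p r)))
    ; (suc i) → trans (coeff-*-suc x p q i)
                  (trans (+-cong (*-congˡ (at e (suc i))) (at (*ₚ-congˡ p e) i))
                         (sym (coeff-*-suc x p r i)))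
    }

  *ₚ-cong : Congruent₂ _≈ₚ_ _*ₚ_
  *ₚ-cong {p} {p′} {q} {q′} e f =
    ≈ₚ-trans (*ₚ-congˡ p f)
      (≈ₚ-trans (*ₚ-comm p q′) (≈ₚ-trans (*ₚ-congˡ q′ e) (*ₚ-comm q′ p′)))

  *ₚ-distribˡ : ∀ p q r → p *ₚ (q +ₚ r) ≈ₚ p *ₚ q +ₚ p *ₚ r
  *ₚ-distribˡ []      q r = ≈ₚ-refl
  *ₚ-distribˡ (x ∷ p) q r = mk λ
    { zero    → begin
        coeff ((x ∷ p) *ₚ (q +ₚ r)) 0                      ≈⟨ coeff-*-zero x p (q +ₚ r) ⟩
        x * coeff (q +ₚ r) 0                               ≈⟨ *-congˡ (coeff-+ q r 0) ⟩
        x * (coeff q 0 + coeff r 0)                        ≈⟨ distribˡ _ _ _ ⟩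
        x * coeff q 0 + x * coeff r 0                      ≈⟨ +-cong (coeff-*-zero x p q) (coeff-*-zero x p r) ⟨
        coeff ((x ∷ p) *ₚ q) 0 + coeff ((x ∷ p) *ₚ r) 0    ≈⟨ coeff-+ ((x ∷ p) *ₚ q) ((x ∷ p) *ₚ r) 0 ⟨
        coeff ((x ∷ p) *ₚ q +ₚ (x ∷ p) *ₚ r) 0             ∎
    ; (suc i) → begin
        coeff ((x ∷ p) *ₚ (q +ₚ r)) (suc i)
          ≈⟨ coeff-*-suc x p (q +ₚ r) i ⟩
        x * coeff (q +ₚ r) (suc i) + coeff (p *ₚ (q +ₚ r)) i
          ≈⟨ +-cong (*-congˡ (coeff-+ q r (suc i)))
                    (trans (at (*ₚ-distribˡ p q r) i) (coeff-+ (p *ₚ q) (p *ₚ r) i)) ⟩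
        x * (coeff q (suc i) + coeff r (suc i)) + (coeff (p *ₚ q) i + coeff (p *ₚ r) i)
          ≈⟨ I.interchange _ _ _ _ _ ⟩
        (x * coeff q (suc i) + coeff (p *ₚ q) i) + (x * coeff r (suc i) + coeff (p *ₚ r) i)
          ≈⟨ +-cong (coeff-*-suc x p q i) (coeff-*-suc x p r i) ⟨
        coeff ((x ∷ p) *ₚ q) (suc i) + coeff ((x ∷ p) *ₚ r) (suc i)
          ≈⟨ coeff-+ ((x ∷ p) *ₚ q) ((x ∷ p) *ₚ r) (suc i) ⟨
        coeff ((x ∷ p) *ₚ q +ₚ (x ∷ p) *ₚ r) (suc i) ∎
    }

  *ₚ-distribʳ : ∀ p q r → (q +ₚ r) *ₚ p ≈ₚ q *ₚ p +ₚ r *ₚ p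
  *ₚ-distribʳ p q r =
    ≈ₚ-trans (*ₚ-comm (q +ₚ r) p)
      (≈ₚ-trans (*ₚ-distribˡ p q r) (+ₚ-cong (*ₚ-comm p q) (*ₚ-comm p r)))

  ·-*ₚ : ∀ x p q → (x · p) *ₚ q ≈ₚ x · (p *ₚ q)
  ·-*ₚ x []      q = ≈ₚ-refl
  ·-*ₚ x (y ∷ p) q = mk λ
    { zero    → begin
        coeff ((x · (y ∷ p)) *ₚ q) 0     ≈⟨ coeff-*-zero (x * y) (x · p) q ⟩
        x * y * coeff q 0                ≈⟨ *-assoc _ _ _ ⟩
        x * (y * coeff q 0)              ≈⟨ *-congˡ (coeff-*-zero y p q) ⟨
        x * coeff ((y ∷ p) *ₚ q) 0       ≈⟨ coeff-· x ((y ∷ p) *ₚ q) 0 ⟨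
        coeff (x · ((y ∷ p) *ₚ q)) 0     ∎
    ; (suc i) → begin
        coeff ((x · (y ∷ p)) *ₚ q) (suc i)
          ≈⟨ coeff-*-suc (x * y) (x · p) q i ⟩
        x * y * coeff q (suc i) + coeff ((x · p) *ₚ q) i
          ≈⟨ +-cong (*-assoc _ _ _) (trans (at (·-*ₚ x p q) i) (coeff-· x (p *ₚ q) i)) ⟩
        x * (y * coeff q (suc i)) + x * coeff (p *ₚ q) i
          ≈⟨ distribˡ _ _ _ ⟨
        x * (y * coeff q (suc i) + coeff (p *ₚ q) i)
          ≈⟨ *-congˡ (coeff-*-suc y p q i) ⟨
        x * coeff ((y ∷ p) *ₚ q) (suc i)
          ≈⟨ coeff-· x ((y ∷ p) *ₚ q) (suc i) ⟨
        coeff (x · ((y ∷ p) *ₚ q)) (suc i) ∎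
    }

  0∷-*ₚ : ∀ p q → (0# ∷ p) *ₚ q ≈ₚ 0# ∷ (p *ₚ q)
  0∷-*ₚ p q = mk λ
    { zero    → trans (coeff-*-zero 0# p q) (zeroˡ _)
    ; (suc i) → trans (coeff-*-suc 0# p q i)
                  (trans (+-congʳ (zeroˡ _)) (+-identityˡ _))
    }

  *ₚ-assoc : ∀ p q r → (p *ₚ q) *ₚ r ≈ₚ p *ₚ (q *ₚ r)
  *ₚ-assoc []      q r = ≈ₚ-refl
  *ₚ-assoc (x ∷ p) q r =
    ≈ₚ-trans (*ₚ-distribʳ r (x · q) (0# ∷ (p *ₚ q)))
      (+ₚ-cong (·-*ₚ x q r)
        (≈ₚ-trans (0∷-*ₚ (p *ₚ q) r)
          (mk λ { zero → refl ; (suc i) → at (*ₚ-assoc p q r) i })))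

  *ₚ-identityˡ : ∀ p → const 1# *ₚ p ≈ₚ p
  *ₚ-identityˡ p = mk λ
    { zero    → trans (coeff-*-zero 1# [] p) (*-identityˡ _)
    ; (suc i) → trans (coeff-*-suc 1# [] p i)
                  (trans (+-identityʳ _) (*-identityˡ _))
    }

  *ₚ-identityʳ : ∀ p → p *ₚ const 1# ≈ₚ p
  *ₚ-identityʳ p = ≈ₚ-trans (*ₚ-comm p (const 1#)) (*ₚ-identityˡ p)

  polyRing : CommutativeRing c ℓ
  polyRing = record
    { Carrier = Poly ; _≈_ = _≈ₚ_ ; _+_ = _+ₚ_ ; _*_ = _*ₚ_ ; -_ = -ₚ_
    ; 0# = [] ; 1# = const 1#
    ; isCommutativeRing = record
      { isRing = record
        { +-isAbelianGroup = record
          { isGroup = record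
            { isMonoid = record
              { isSemigroup = record
                { isMagma = record
                  { isEquivalence = record
                    { refl = ≈ₚ-refl ; sym = ≈ₚ-sym ; trans = ≈ₚ-trans }
                  ; ∙-cong = +ₚ-cong }
                ; assoc = +ₚ-assoc }
              ; identity = +ₚ-identityˡ , +ₚ-identityʳ }
            ; inverse = -ₚ-inverseˡ , -ₚ-inverseʳ
            ; ⁻¹-cong = -ₚ-cong }
          ; comm = +ₚ-comm }
        ; *-cong = *ₚ-cong
        ; *-assoc = *ₚ-assoc
        ; *-identity = *ₚ-identityˡ , *ₚ-identityʳ
        ; distrib = *ₚ-distribˡ , *ₚ-distribʳ }
      ; *-comm = *ₚ-comm }
    }

  private
    ∷-cong : ∀ {x y p q} → x ≈ y → p ≈ₚ q → x ∷ p ≈ₚ y ∷ q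
    ∷-cong e f = mk λ { zero → e ; (suc i) → at f i }

    ∷≈[] : ∀ {x p} → x ≈ 0# → p ≈ₚ [] → x ∷ p ≈ₚ []
    ∷≈[] e f = mk λ { zero → e ; (suc i) → at f i }

  _≟ₚ_ : Decidable _≈ₚ_
  []      ≟ₚ []      = yes ≈ₚ-refl
  []      ≟ₚ (y ∷ q) with y ≟ 0# | [] ≟ₚ q
  ... | yes e | yes f = yes (≈ₚ-sym (∷≈[] e (≈ₚ-sym f)))
  ... | no ¬e | _     = no λ g → ¬e (sym (at g 0))
  ... | _     | no ¬f = no λ g → ¬f (mk λ i → at g (suc i))
  (x ∷ p) ≟ₚ []      with x ≟ 0# | p ≟ₚ []
  ... | yes e | yes f = yes (∷≈[] e f)
  ... | no ¬e | _     = no λ g → ¬e (at g 0)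
  ... | _     | no ¬f = no λ g → ¬f (mk λ i → at g (suc i))
  (x ∷ p) ≟ₚ (y ∷ q) with x ≟ y | p ≟ₚ q
  ... | yes e | yes f = yes (∷-cong e f)
  ... | no ¬e | _     = no λ g → ¬e (at g 0)
  ... | _     | no ¬f = no λ g → ¬f (mk λ i → at g (suc i))

  noZeroDivisorsₚ : ∀ p q → p *ₚ q ≈ₚ [] → p ≈ₚ [] ⊎ q ≈ₚ []
  noZeroDivisorsₚ []      q       e = inj₁ ≈ₚ-refl
  noZeroDivisorsₚ (x ∷ p) []      e = inj₂ ≈ₚ-refl
  noZeroDivisorsₚ (x ∷ p) (y ∷ q) =
    step (x ≟ 0#) (y ≟ 0#) (noZeroDivisorsₚ p (y ∷ q)) (noZeroDivisorsₚ (x ∷ p) q)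
    where
    NZD : Poly → Poly → Set ℓ
    NZD p q = p *ₚ q ≈ₚ [] → p ≈ₚ [] ⊎ q ≈ₚ []

    step : Dec (x ≈ 0#) → Dec (y ≈ 0#) →
           NZD p (y ∷ q) → NZD (x ∷ p) q → NZD (x ∷ p) (y ∷ q)
    step (yes x≈0) _ rec₁ rec₂ e =
      [ (λ f → inj₁ (∷≈[] x≈0 f)) , inj₂ ]′
        (rec₁ (mk λ i → begin
          coeff (p *ₚ (y ∷ q)) i               ≈⟨ +-identityˡ _ ⟨
          0# + coeff (p *ₚ (y ∷ q)) i          ≈⟨ +-congʳ (trans (*-congʳ x≈0) (zeroˡ _)) ⟨
          x * coeff q i + coeff (p *ₚ (y ∷ q)) i ≈⟨ coeff-*-suc x p (y ∷ q) i ⟨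
          coeff ((x ∷ p) *ₚ (y ∷ q)) (suc i)   ≈⟨ at e (suc i) ⟩
          0#                                   ∎))
    step (no _) (yes y≈0) rec₁ rec₂ e =
      [ inj₁ , (λ f → inj₂ (∷≈[] y≈0 f)) ]′
        (rec₂ (mk λ i → begin
          coeff ((x ∷ p) *ₚ q) i               ≈⟨ +-identityˡ _ ⟨
          0# + coeff ((x ∷ p) *ₚ q) i          ≈⟨ +-congʳ (trans (*-congʳ y≈0) (zeroˡ _)) ⟨
          y * coeff p i + coeff ((x ∷ p) *ₚ q) i ≈⟨ coeff-*-∷ʳ-suc (x ∷ p) y q i ⟨
          coeff ((x ∷ p) *ₚ (y ∷ q)) (suc i)   ≈⟨ at e (suc i) ⟩
          0#                                   ∎))
    step (no x≉0) (no y≉0) rec₁ rec₂ e =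
      ⊥-elim ([ x≉0 , y≉0 ]′
        (noZeroDivisors x y (trans (sym (coeff-*-zero x p (y ∷ q))) (at e 0))))

  domain : DiscreteDomain c ℓ
  domain = record
    { commutativeRing = polyRing
    ; _≟_             = _≟ₚ_
    ; 1≉0             = λ e → 1≉0 (at e 0)
    ; noZeroDivisors  = noZeroDivisorsₚ
    }

module FractionField (D : DiscreteDomain c ℓ) where
  open DiscreteDomain D
  open RingProperties ring using (x≈y⇒x∙y⁻¹≈ε; x∙y⁻¹≈ε⇒x≈y; -‿distribˡ-*; -‿distribʳ-*)
  open SetoidReasoning setoid

  private
    module I = RingIdentities commutativeRing

  infix 5 _//_[_]
  record Frac : Set (c ⊔ ℓ) where
    constructor _//_[_]
    field
      num   : Carrier
      den   : Carrier
      den≉0 : ¬ den ≈ 0#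
  open Frac public

  infix 4 _≈ᶠ_
  record _≈ᶠ_ (x y : Frac) : Set ℓ where
    constructor mk
    field cross : num x * den y ≈ num y * den x
  open _≈ᶠ_ public

  private
    *-≉0 : ∀ {x y} → ¬ x ≈ 0# → ¬ y ≈ 0# → ¬ x * y ≈ 0#
    *-≉0 {x} {y} x≉0 y≉0 e = [ x≉0 , y≉0 ]′ (noZeroDivisors x y e)

    *-cancelʳ : ∀ {x y z} → ¬ z ≈ 0# → x * z ≈ y * z → x ≈ y
    *-cancelʳ {x} {y} {z} z≉0 e =
      [ x∙y⁻¹≈ε⇒x≈y x y , ⊥-elim ∘ z≉0 ]′
        (noZeroDivisors (x - y) z (begin
          (x - y) * z          ≈⟨ distribʳ z x (- y) ⟩
          x * z + - y * z      ≈⟨ +-congˡ (-‿distribˡ-* y z) ⟨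
          x * z - y * z        ≈⟨ x≈y⇒x∙y⁻¹≈ε e ⟩
          0#                   ∎))

  ι : Carrier → Frac
  ι x = x // 1# [ 1≉0 ]

  infixl 6 _+ᶠ_
  infixl 7 _*ᶠ_
  infix  8 -ᶠ_

  _+ᶠ_ : Frac → Frac → Frac
  (m // d [ d≉0 ]) +ᶠ (n // e [ e≉0 ]) = (m * e + n * d) // d * e [ *-≉0 d≉0 e≉0 ]

  _*ᶠ_ : Frac → Frac → Frac
  (m // d [ d≉0 ]) *ᶠ (n // e [ e≉0 ]) = m * n // d * e [ *-≉0 d≉0 e≉0 ]

  -ᶠ_ : Frac → Frac
  -ᶠ (m // d [ d≉0 ]) = - m // d [ d≉0 ]

  -- Total inverse, with the convention that the inverse of 0 is 0.
  infix 8 _⁻¹ᶠ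
  _⁻¹ᶠ : Frac → Frac
  (m // d [ d≉0 ]) ⁻¹ᶠ with m ≟ 0#
  ... | yes _   = ι 0#
  ... | no  m≉0 = d // m [ m≉0 ]

  infixl 7 _/ᶠ_
  _/ᶠ_ : Frac → Frac → Frac
  x /ᶠ y = x *ᶠ y ⁻¹ᶠ

  ≈ᶠ-refl : ∀ {x} → x ≈ᶠ x
  ≈ᶠ-refl = mk refl

  ≈ᶠ-sym : ∀ {x y} → x ≈ᶠ y → y ≈ᶠ x
  ≈ᶠ-sym e = mk (sym (cross e))

  ≈ᶠ-trans : ∀ {x y z} → x ≈ᶠ y → y ≈ᶠ z → x ≈ᶠ z
  ≈ᶠ-trans {m // d [ _ ]} {n // e [ e≉0 ]} {o // f [ _ ]} p q =
    mk (*-cancelʳ e≉0 (begin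
      m * f * e   ≈⟨ I.s1 m f e ⟩
      m * e * f   ≈⟨ *-congʳ (cross p) ⟩
      n * d * f   ≈⟨ I.s1 n d f ⟩
      n * f * d   ≈⟨ *-congʳ (cross q) ⟩
      o * e * d   ≈⟨ I.s1 o e d ⟩
      o * d * e   ∎))

  +ᶠ-cong : Congruent₂ _≈ᶠ_ _+ᶠ_
  +ᶠ-cong {m₁ // d₁ [ _ ]} {n₁ // e₁ [ _ ]} {m₂ // d₂ [ _ ]} {n₂ // e₂ [ _ ]} p q = mk (begin
    (m₁ * d₂ + m₂ * d₁) * (e₁ * e₂)                  ≈⟨ I.s2 m₁ d₁ m₂ d₂ e₁ e₂ ⟩
    (m₁ * e₁) * (d₂ * e₂) + (m₂ * e₂) * (d₁ * e₁)    ≈⟨ +-cong (*-congʳ (cross p)) (*-congʳ (cross q)) ⟩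
    (n₁ * d₁) * (d₂ * e₂) + (n₂ * d₂) * (d₁ * e₁)    ≈⟨ I.s3 n₁ d₁ n₂ d₂ e₁ e₂ ⟩
    (n₁ * e₂ + n₂ * e₁) * (d₁ * d₂)                  ∎)

  *ᶠ-cong : Congruent₂ _≈ᶠ_ _*ᶠ_
  *ᶠ-cong {m₁ // d₁ [ _ ]} {n₁ // e₁ [ _ ]} {m₂ // d₂ [ _ ]} {n₂ // e₂ [ _ ]} p q = mk (begin
    (m₁ * m₂) * (e₁ * e₂)  ≈⟨ I.s4 m₁ m₂ e₁ e₂ ⟩
    (m₁ * e₁) * (m₂ * e₂)  ≈⟨ *-cong (cross p) (cross q) ⟩
    (n₁ * d₁) * (n₂ * d₂)  ≈⟨ I.s4 n₁ n₂ d₁ d₂ ⟨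
    (n₁ * n₂) * (d₁ * d₂)  ∎)

  -ᶠ-cong : Congruent₁ _≈ᶠ_ -ᶠ_
  -ᶠ-cong {m // d [ _ ]} {n // e [ _ ]} p = mk (begin
    - m * e     ≈⟨ -‿distribˡ-* m e ⟨
    - (m * e)   ≈⟨ -‿cong (cross p) ⟩
    - (n * d)   ≈⟨ -‿distribˡ-* n d ⟩
    - n * d     ∎)

  +ᶠ-assoc : ∀ x y z → (x +ᶠ y) +ᶠ z ≈ᶠ x +ᶠ (y +ᶠ z)
  +ᶠ-assoc (m // d [ _ ]) (n // e [ _ ]) (o // f [ _ ]) = mk (I.s5 m d n e o f)

  +ᶠ-comm : ∀ x y → x +ᶠ y ≈ᶠ y +ᶠ x
  +ᶠ-comm (m // d [ _ ]) (n // e [ _ ]) = mk (I.s6 m d n e)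

  +ᶠ-identityˡ : ∀ x → ι 0# +ᶠ x ≈ᶠ x
  +ᶠ-identityˡ (m // d [ _ ]) = mk (begin
    (0# * d + m * 1#) * d  ≈⟨ *-congʳ (+-cong (zeroˡ d) (*-identityʳ m)) ⟩
    (0# + m) * d           ≈⟨ *-cong (+-identityˡ m) (sym (*-identityˡ d)) ⟩
    m * (1# * d)           ∎)

  -ᶠ-inverseˡ : ∀ x → -ᶠ x +ᶠ x ≈ᶠ ι 0#
  -ᶠ-inverseˡ (m // d [ _ ]) = mk (begin
    (- m * d + m * d) * 1#  ≈⟨ *-identityʳ _ ⟩
    - m * d + m * d         ≈⟨ distribʳ d (- m) m ⟨
    (- m + m) * d           ≈⟨ *-congʳ (-‿inverseˡ m) ⟩
    0# * d                  ≈⟨ zeroˡ d ⟩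
    0#                      ≈⟨ zeroˡ (d * d) ⟨
    0# * (d * d)            ∎)

  *ᶠ-assoc : ∀ x y z → (x *ᶠ y) *ᶠ z ≈ᶠ x *ᶠ (y *ᶠ z)
  *ᶠ-assoc (m // d [ _ ]) (n // e [ _ ]) (o // f [ _ ]) = mk (I.s7 m n o d e f)

  *ᶠ-comm : ∀ x y → x *ᶠ y ≈ᶠ y *ᶠ x
  *ᶠ-comm (m // d [ _ ]) (n // e [ _ ]) = mk (I.s8 m n d e)

  *ᶠ-identityˡ : ∀ x → ι 1# *ᶠ x ≈ᶠ x
  *ᶠ-identityˡ (m // d [ _ ]) =
    mk (*-cong (*-identityˡ m) (sym (*-identityˡ d)))

  *ᶠ-distribˡ : ∀ x y z → x *ᶠ (y +ᶠ z) ≈ᶠ x *ᶠ y +ᶠ x *ᶠ z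
  *ᶠ-distribˡ (m // d [ _ ]) (n // e [ _ ]) (o // f [ _ ]) = mk (I.s9 m d n e o f)

  *ᶠ-distribʳ : ∀ x y z → (y +ᶠ z) *ᶠ x ≈ᶠ y *ᶠ x +ᶠ z *ᶠ x
  *ᶠ-distribʳ x y z =
    ≈ᶠ-trans (*ᶠ-comm (y +ᶠ z) x)
      (≈ᶠ-trans (*ᶠ-distribˡ x y z) (+ᶠ-cong (*ᶠ-comm x y) (*ᶠ-comm x z)))

  fracRing : CommutativeRing (c ⊔ ℓ) ℓ
  fracRing = record
    { Carrier = Frac ; _≈_ = _≈ᶠ_ ; _+_ = _+ᶠ_ ; _*_ = _*ᶠ_ ; -_ = -ᶠ_
    ; 0# = ι 0# ; 1# = ι 1#
    ; isCommutativeRing = record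
      { isRing = record
        { +-isAbelianGroup = record
          { isGroup = record
            { isMonoid = record
              { isSemigroup = record
                { isMagma = record
                  { isEquivalence = record
                    { refl = ≈ᶠ-refl ; sym = ≈ᶠ-sym ; trans = ≈ᶠ-trans }
                  ; ∙-cong = +ᶠ-cong }
                ; assoc = +ᶠ-assoc }
              ; identity = +ᶠ-identityˡ
                         , λ x → ≈ᶠ-trans (+ᶠ-comm x (ι 0#)) (+ᶠ-identityˡ x) }
            ; inverse = -ᶠ-inverseˡ
                      , λ x → ≈ᶠ-trans (+ᶠ-comm x (-ᶠ x)) (-ᶠ-inverseˡ x)
            ; ⁻¹-cong = -ᶠ-cong }
          ; comm = +ᶠ-comm }
        ; *-cong = *ᶠ-cong
        ; *-assoc = *ᶠ-assoc
        ; *-identity = *ᶠ-identityˡ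
                     , λ x → ≈ᶠ-trans (*ᶠ-comm x (ι 1#)) (*ᶠ-identityˡ x)
        ; distrib = *ᶠ-distribˡ , *ᶠ-distribʳ }
      ; *-comm = *ᶠ-comm }
    }

  num≈0⇒≈0 : ∀ {x} → num x ≈ 0# → x ≈ᶠ ι 0#
  num≈0⇒≈0 {m // d [ _ ]} e =
    mk (trans (*-identityʳ m) (trans e (sym (zeroˡ d))))

  ≈0⇒num≈0 : ∀ {x} → x ≈ᶠ ι 0# → num x ≈ 0#
  ≈0⇒num≈0 {m // d [ _ ]} e =
    trans (sym (*-identityʳ m)) (trans (cross e) (zeroˡ d))

  ⁻¹ᶠ-inverseʳ : ∀ x → ¬ x ≈ᶠ ι 0# → x *ᶠ x ⁻¹ᶠ ≈ᶠ ι 1#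
  ⁻¹ᶠ-inverseʳ (m // d [ _ ]) x≉0 with m ≟ 0#
  ... | yes m≈0 = ⊥-elim (x≉0 (num≈0⇒≈0 m≈0))
  ... | no  _   = mk (trans (*-identityʳ _) (trans (*-comm m d) (sym (*-identityˡ _))))

  noZeroDivisorsᶠ : ∀ x y → x *ᶠ y ≈ᶠ ι 0# → x ≈ᶠ ι 0# ⊎ y ≈ᶠ ι 0#
  noZeroDivisorsᶠ x y e =
    [ inj₁ ∘ num≈0⇒≈0 , inj₂ ∘ num≈0⇒≈0 ]′
      (noZeroDivisors (num x) (num y) (≈0⇒num≈0 e))

  ι-* : ∀ x y → ι (x * y) ≈ᶠ ι x *ᶠ ι y
  ι-* x y = mk (*-congˡ (*-identityˡ 1#))

  ι-injective : ∀ {x y} → ι x ≈ᶠ ι y → x ≈ y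
  ι-injective e = trans (sym (*-identityʳ _)) (trans (cross e) (*-identityʳ _))

-- The field ℚ(a,b,q) = Frac ℚ[a][b][q]

module ℚ[a]       = Polynomial ℚ-domain
module ℚ[a][b]    = Polynomial ℚ[a].domain
module ℚ[a][b][q] = Polynomial ℚ[a][b].domain

open FractionField ℚ[a][b][q].domain public
  using (ι; ⁻¹ᶠ-inverseʳ; noZeroDivisorsᶠ)
  renaming (fracRing to ℚ⟨a,b,q⟩; _⁻¹ᶠ to _⁻¹; _/ᶠ_ to _/_)

open CommutativeRing ℚ⟨a,b,q⟩ public
  using (_≈_; _+_; _*_; _-_; -_; 0#; 1#) renaming (Carrier to K)
open SemiringExp (CommutativeRing.semiring ℚ⟨a,b,q⟩) public using (_^_)
open RingNotions ℚ⟨a,b,q⟩ public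

a b q : K
a = ι (ℚ[a][b][q].const (ℚ[a][b].const ℚ[a].X))
b = ι (ℚ[a][b][q].const ℚ[a][b].X)
q = ι ℚ[a][b][q].X

μ : ℕ → K
μ m = ⟨ a * q ⨾ q ⟩ m / ⟨ a * b * q ^ 2 ⨾ q ⟩ m

-- Every denominator (abqʳ;q)ₘ is nonzero, so the convention 0 ⁻¹ = 0 plays no
-- role for the quotients formed with _/_ from such denominators.
module Nonvanishing where
  open CommutativeRing ℚ⟨a,b,q⟩ using (sym; trans; *-cong; *-congˡ; *-congʳ; *-assoc; refl; setoid; ring)
  open RingProperties ring using (x∙y⁻¹≈ε⇒x≈y)
  open SetoidReasoning setoid
  open FractionField ℚ[a][b][q].domain using (ι-*; ι-injective)
  private
    module ℚR  = DiscreteDomain ℚ-domain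
    module P   = DiscreteDomain ℚ[a][b][q].domain

    constantTerm : P.Carrier → ℚR.Carrier
    constantTerm p = ℚ[a].coeff (ℚ[a][b].coeff (ℚ[a][b][q].coeff p 0) 0) 0

    constantTerm-cong : ∀ {p r} → p P.≈ r → constantTerm p ≡ constantTerm r
    constantTerm-cong e = ℚ[a].at (ℚ[a][b].at (ℚ[a][b][q].at e 0) 0) 0

    constantTerm-* : ∀ p r → constantTerm (p P.* r) ≡ constantTerm p ℚR.* constantTerm r
    constantTerm-* p r =
      ≡.trans (ℚ[a].at (ℚ[a][b].at (ℚ[a][b][q].coeff₀-* p r) 0) 0)
        (≡.trans (ℚ[a].at (ℚ[a][b].coeff₀-* (ℚ[a][b][q].coeff p 0) (ℚ[a][b][q].coeff r 0)) 0)
          (ℚ[a].coeff₀-* (ℚ[a][b].coeff (ℚ[a][b][q].coeff p 0) 0)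
                         (ℚ[a][b].coeff (ℚ[a][b][q].coeff r 0) 0)))

    X^ : ℕ → P.Carrier
    X^ zero    = P.1#
    X^ (suc n) = ℚ[a][b][q].X P.* X^ n

    q^≈ι : ∀ n → q ^ n ≈ ι (X^ n)
    q^≈ι zero    = refl
    q^≈ι (suc n) = trans (*-congˡ {q} (q^≈ι n)) (sym (ι-* ℚ[a][b][q].X (X^ n)))

    aₚ bₚ : P.Carrier
    aₚ = ℚ[a][b][q].const (ℚ[a][b].const ℚ[a].X)
    bₚ = ℚ[a][b][q].const ℚ[a][b].X

    factor≉0 : ∀ r k → ¬ 1# - a * b * q ^ r * q ^ k ≈ 0#
    factor≉0 r k e = ℚR.1≉0 (≡.trans (constantTerm-cong (ι-injective 1≈))
      (≡.trans (constantTerm-* aₚ w) (ℚR.zeroˡ (constantTerm w))))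
      where
      w : P.Carrier
      w = bₚ P.* (X^ r P.* X^ k)

      1≈ : 1# ≈ ι (aₚ P.* w)
      1≈ = begin
        1#                               ≈⟨ x∙y⁻¹≈ε⇒x≈y _ _ e ⟩
        a * b * q ^ r * q ^ k            ≈⟨ *-assoc (a * b) (q ^ r) (q ^ k) ⟩
        a * b * (q ^ r * q ^ k)          ≈⟨ *-assoc a b (q ^ r * q ^ k) ⟩
        a * (b * (q ^ r * q ^ k))        ≈⟨ *-congˡ {a} (*-congˡ {b} (*-cong (q^≈ι r) (q^≈ι k))) ⟩
        a * (b * (ι (X^ r) * ι (X^ k)))  ≈⟨ *-congˡ {a} (*-congˡ {b} (ι-* (X^ r) (X^ k))) ⟨
        a * (b * ι (X^ r P.* X^ k))      ≈⟨ *-congˡ {a} (ι-* bₚ (X^ r P.* X^ k)) ⟨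
        a * ι w                          ≈⟨ ι-* aₚ w ⟨
        ι (aₚ P.* w)                     ∎

    product≉0 : ∀ {m} (f : Fin m → K) → (∀ k → ¬ f k ≈ 0#) →
                ¬ MonoidSum.sum (CommutativeRing.*-commutativeMonoid ℚ⟨a,b,q⟩) f ≈ 0#
    product≉0 {zero}  f f≉0 e = P.1≉0 (ι-injective e)
    product≉0 {suc m} f f≉0 e =
      [ f≉0 zero , product≉0 (f ∘ suc) (f≉0 ∘ suc) ]′ (noZeroDivisorsᶠ (f zero) _ e)

  denominator≉0 : ∀ r m → ¬ ⟨ a * b * q ^ r ⨾ q ⟩ m ≈ 0#
  denominator≉0 r m = product≉0 {m} _ λ k → factor≉0 r (toℕ k)

{-# OPTIONS --safe #-}
module Submission where

-- Shifting the index by t replaces aq, abq² by x = aqᵗ⁺¹, xy = abqᵗ⁺² with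
-- y = bq, up to a common factor of all entries, so let
-- H n x y = det ((x;q)ᵢ₊ⱼ / (xy;q)ᵢ₊ⱼ). Going from right to left, subtract from
-- column j+1 the multiple (1 - xqʲ) / (1 - xyqʲ) of column j. Row 0 becomes
-- (1, 0, …, 0), and since
--   (1 - xuz)(1 - xyz) - (1 - xz)(1 - xyuz) = z x (1 - y)(1 - u),
-- with u = qⁱ and z = qʲ, the remaining minor is the matrix of H (n-1) (xq) (yq)
-- with rows and columns rescaled. The product side satisfies the same recursion.
--
-- Working in an arbitrary commutative ring, with the inverses of the 1 - xyqᵏ
-- supplied as a sequence, avoids all nonvanishing conditions.

open import Algebra.Bundles using (CommutativeRing)
import Algebra.Properties.CommutativeMonoid.Sum as MonoidSum
import Algebra.Properties.CommutativeSemiring.Exp as CommutativeSemiringExp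
import Algebra.Properties.Ring as RingProperties
import Algebra.Properties.Semiring.Exp as SemiringExp
import Algebra.Properties.Semiring.Sum as SemiringSum
import Algebra.Solver.Ring.NaturalCoefficients.Default as NaturalCoefficients
open import Data.Empty using (⊥-elim)
open import Data.Fin.Base using (Fin; zero; suc; toℕ; punchIn; punchOut; inject₁)
open import Data.Fin.Properties as Fin using (punchIn-punchOut; punchInᵢ≢i; toℕ-inject₁)
open import Data.Nat.Base as ℕ using (ℕ; zero; suc; NonZero)
import Data.Nat.DivMod as ℕ
import Data.Nat.Properties as ℕ
import Data.Nat.Solver as ℕ
open import Data.Product.Base using (∃; _×_; _,_)
open import Data.Vec.Functional using (_∷_)
open import Function.Base using (_∘_)
open import Level using (Level)
import Relation.Binary.Reasoning.Setoid as SetoidReasoning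
open import Relation.Binary.PropositionalEquality as ≡ using (_≡_; _≢_)
open import Relation.Nullary using (¬_; yes; no)

open import Defs using (module RingNotions)

-- Determinants over a commutative ring: scaling and column operations.

-- Lets the induction on equal adjacent columns pass to minors: a column deleted outside the pair
-- does not separate its members.
punchIn-adjacent : ∀ {n} (j : Fin (suc (suc n))) (k : Fin (suc n)) →
  j ≢ inject₁ k → j ≢ suc k →
  ∃ λ (k′ : Fin n) → punchIn j (inject₁ k′) ≡ inject₁ k × punchIn j (suc k′) ≡ suc k
punchIn-adjacent zero          zero    j≢k _  = ⊥-elim (j≢k ≡.refl)
punchIn-adjacent {suc n} zero          (suc k) _ _ = k , ≡.refl , ≡.refl
punchIn-adjacent (suc zero)    zero    _ j≢sk = ⊥-elim (j≢sk ≡.refl)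
punchIn-adjacent {suc n} (suc (suc j)) zero _ _ = zero , ≡.refl , ≡.refl
punchIn-adjacent {suc n} (suc j)       (suc k) j≢k j≢sk
  with k′ , e , f ← punchIn-adjacent j k (j≢k ∘ ≡.cong suc) (j≢sk ∘ ≡.cong suc)
  = suc k′ , ≡.cong suc e , ≡.cong suc f

module Determinants {c ℓ : Level} (R : CommutativeRing c ℓ) where
  open CommutativeRing R hiding (zero)
  open RingNotions R
  open SemiringExp semiring using (_^_)
  open SemiringSum semiring using
    (sum; sum-cong-≋; sum-replicate-zero; ∑-distrib-+; *-distribˡ-sum)
  open MonoidSum *-commutativeMonoid using ()
    renaming (sum to product; sum-remove to product-remove)
  open RingProperties ring using (-1*x≈-x)
  open NaturalCoefficients commutativeSemiring using (solve; _:=_; _:+_; _:*_)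
  open SetoidReasoning setoid

  private
    reindex : ∀ {n} (f : Fin n → Carrier) {i j} → i ≡ j → f i ≈ f j
    reindex f ≡.refl = refl

  minor : ∀ {n} → Fin (suc n) → Matrix (suc n) → Matrix n
  minor j A i k = A (suc i) (punchIn j k)

  private
    ± : ∀ {n} → Fin n → Carrier
    ± j = (- 1#) ^ toℕ j

    term : ∀ {n} → Matrix (suc n) → Fin (suc n) → Carrier
    term A j = (± j * A zero j) * det (minor j A)

    sum-cong : ∀ {n} (f g : Fin n → Carrier) → (∀ j → f j ≈ g j) → sum f ≈ sum g
    sum-cong f g f≈g = sum-cong-≋ {x = f} {y = g} f≈g

  det-cong : ∀ {n} {A B : Matrix n} → (∀ i j → A i j ≈ B i j) → det A ≈ det B
  det-cong {zero}          A≈B = refl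
  det-cong {suc n} {A} {B} A≈B = sum-cong (term A) (term B) λ j →
    *-cong (*-congˡ {± j} (A≈B zero j)) (det-cong λ i k → A≈B (suc i) (punchIn j k))

  -- Each Laplace term takes `r zero` and `s j` from the expanded entry and the other factors from
  -- the minor. By `product-remove`, `s j` and the factors of the remaining columns make up all of
  -- `product s`, whatever `j` is.
  det-scale : ∀ {n} (r s : Fin n → Carrier) (A : Matrix n) →
    det (λ i j → (r i * s j) * A i j) ≈ product r * product s * det A
  det-scale {zero}  r s A = sym (trans (*-congʳ (*-identityˡ 1#)) (*-identityˡ 1#))
  det-scale {suc n} r s A = begin
    sum (term rAs)                                ≈⟨ sum-cong _ _ termwise ⟩
    sum (λ j → product r * product s * term A j)  ≈⟨ *-distribˡ-sum (product r * product s) (term A) ⟨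
    product r * product s * det A                 ∎
    where
    rAs : Matrix (suc n)
    rAs i j = (r i * s j) * A i j

    regroup : ∀ e x y z u v w →
      (e * (x * y * z)) * (u * v * w) ≈ (x * u) * (y * v) * ((e * z) * w)
    regroup = solve 7 (λ e x y z u v w →
      (e :* (x :* y :* z)) :* (u :* v :* w) := (x :* u) :* (y :* v) :* ((e :* z) :* w)) refl

    termwise : ∀ j → term rAs j ≈ product r * product s * term A j
    termwise j = begin
      (± j * (r zero * s j * A zero j)) * det (minor j rAs)
        ≈⟨ *-congˡ (det-scale (r ∘ suc) (s ∘ punchIn j) (minor j A)) ⟩
      (± j * (r zero * s j * A zero j))
        * (product (r ∘ suc) * product (s ∘ punchIn j) * det (minor j A))
        ≈⟨ regroup (± j) (r zero) (s j) (A zero j) (product (r ∘ suc)) _ _ ⟩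
      product r * (s j * product (s ∘ punchIn j)) * term A j
        ≈⟨ *-congʳ (*-congˡ (product-remove {i = j} s)) ⟨
      product r * product s * term A j ∎

  -- Every term of the expansion involves column `k` exactly once, either through its row 0 entry or
  -- through its minor.
  det-linear-column : ∀ {n} (A B C : Matrix n) (k : Fin n) x →
    (∀ i j → j ≢ k → C i j ≈ A i j) → (∀ i j → j ≢ k → C i j ≈ B i j) →
    (∀ i → C i k ≈ A i k + x * B i k) → det C ≈ det A + x * det B
  det-linear-column {suc n} A B C k x C≈A C≈B Cₖ = begin
    sum (term C)                             ≈⟨ sum-cong _ _ termwise ⟩
    sum (λ j → term A j + x * term B j)      ≈⟨ ∑-distrib-+ (term A) (λ j → x * term B j) ⟩
    sum (term A) + sum (λ j → x * term B j)  ≈⟨ +-congˡ (*-distribˡ-sum x (term B)) ⟨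
    sum (term A) + x * sum (term B)          ∎
    where
    termwise : ∀ j → term C j ≈ term A j + x * term B j
    termwise j with j Fin.≟ k
    -- The minors omit column `k`, so they agree; linearity comes from the entry.
    ... | yes ≡.refl = begin
      (e * C zero j) * det (minor j C)
        ≈⟨ *-congʳ (*-congˡ (Cₖ zero)) ⟩
      (e * (A zero j + x * B zero j)) * det (minor j C)
        ≈⟨ solve 5 (λ e u x v d → (e :* (u :+ x :* v)) :* d
             := (e :* u) :* d :+ x :* ((e :* v) :* d)) refl _ _ _ _ _ ⟩
      (e * A zero j) * det (minor j C) + x * ((e * B zero j) * det (minor j C))
        ≈⟨ +-cong (*-congˡ (det-cong λ i m → C≈A (suc i) _ (punchInᵢ≢i j m)))
                  (*-congˡ (*-congˡ (det-cong λ i m → C≈B (suc i) _ (punchInᵢ≢i j m)))) ⟩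
      term A j + x * term B j ∎
      where e = ± j
    -- Column `k` survives as column `k′` of the minor, where induction applies.
    ... | no j≢k = begin
      (e * C zero j) * det (minor j C)
        ≈⟨ *-congˡ (det-linear-column (minor j A) (minor j B) (minor j C) k′ x
             (λ i m m≢k′ → C≈A (suc i) _ (off m≢k′))
             (λ i m m≢k′ → C≈B (suc i) _ (off m≢k′))
             (λ i → begin
               C (suc i) (punchIn j k′)  ≈⟨ reindex (C (suc i)) k′↦k ⟩
               C (suc i) k               ≈⟨ Cₖ (suc i) ⟩
               A (suc i) k + x * B (suc i) k
                 ≈⟨ +-cong (reindex (A (suc i)) k′↦k) (*-congˡ (reindex (B (suc i)) k′↦k)) ⟨
               A (suc i) (punchIn j k′) + x * B (suc i) (punchIn j k′) ∎)) ⟩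
      (e * C zero j) * (det (minor j A) + x * det (minor j B))
        ≈⟨ solve 5 (λ e u x v w → (e :* u) :* (v :+ x :* w)
             := (e :* u) :* v :+ x :* ((e :* u) :* w)) refl _ _ _ _ _ ⟩
      (e * C zero j) * det (minor j A) + x * ((e * C zero j) * det (minor j B))
        ≈⟨ +-cong (*-congʳ (*-congˡ (C≈A zero j j≢k)))
                  (*-congˡ (*-congʳ (*-congˡ (C≈B zero j j≢k)))) ⟩
      term A j + x * term B j ∎
      where
      e = ± j
      k′ = punchOut j≢k
      k′↦k = punchIn-punchOut j≢k
      off : ∀ {m} → m ≢ k′ → punchIn j m ≢ k
      off m≢k′ p = m≢k′ (Fin.punchIn-injective j _ _ (≡.trans p (≡.sym k′↦k)))

  private
    sum-adjacent : ∀ {n} (f : Fin (suc n) → Carrier) (k : Fin n) →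
      (∀ j → j ≢ inject₁ k → j ≢ suc k → f j ≈ 0#) →
      f (inject₁ k) + f (suc k) ≈ 0# → sum f ≈ 0#
    sum-adjacent {suc n} f zero f≈0 e = begin
      f zero + (f (suc zero) + sum (λ j → f (suc (suc j))))
        ≈⟨ +-congˡ (+-congˡ (trans (sum-cong-≋ (λ j → f≈0 (suc (suc j)) (λ ()) λ ()))
                                   (sum-replicate-zero n))) ⟩
      f zero + (f (suc zero) + 0#)  ≈⟨ +-congˡ (+-identityʳ _) ⟩
      f zero + f (suc zero)         ≈⟨ e ⟩
      0#                            ∎
    sum-adjacent {suc n} f (suc k) f≈0 e = begin
      f zero + sum (f ∘ suc)
        ≈⟨ +-cong (f≈0 zero (λ ()) λ ())
             (sum-adjacent (f ∘ suc) k
               (λ j p r → f≈0 (suc j) (p ∘ Fin.suc-injective) (r ∘ Fin.suc-injective)) e) ⟩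
      0# + 0#  ≈⟨ +-identityˡ 0# ⟩
      0#       ∎

    -- The two deletions differ only at position `k`, where one leaves `suc k` and the other
    -- `inject₁ k`.
    punchIn-swap : ∀ {n} (f : Fin (suc n) → Carrier) (k : Fin n) → f (inject₁ k) ≈ f (suc k) →
      ∀ m → f (punchIn (inject₁ k) m) ≈ f (punchIn (suc k) m)
    punchIn-swap f zero    e zero    = sym e
    punchIn-swap f zero    e (suc m) = refl
    punchIn-swap f (suc k) e zero    = refl
    punchIn-swap f (suc k) e (suc m) = punchIn-swap (f ∘ suc) k e m

  -- A minor that keeps both columns vanishes by induction. The two other terms have equal entries
  -- and equal minors but opposite signs. Nothing is divided by 2, so the argument works in every
  -- characteristic.
  det-equal-adjacent-columns : ∀ {n} (A : Matrix (suc n)) (k : Fin n) →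
    (∀ i → A i (inject₁ k) ≈ A i (suc k)) → det A ≈ 0#
  det-equal-adjacent-columns {suc n} A k e = sum-adjacent (term A) k others cancel
    where
    others : ∀ j → j ≢ inject₁ k → j ≢ suc k →
      term A j ≈ 0#
    others j p r with k′ , u , v ← punchIn-adjacent j k p r =
      trans (*-congˡ (det-equal-adjacent-columns (minor j A) k′ λ i →
               trans (reindex (A (suc i)) u) (trans (e (suc i)) (sym (reindex (A (suc i)) v)))))
            (zeroʳ _)

    s = (- 1#) ^ toℕ k
    x = A zero (suc k)
    d = det (minor (suc k) A)

    cancel : term A (inject₁ k) + term A (suc k) ≈ 0#
    cancel = begin
      term A (inject₁ k) + (((- 1#) * s) * x) * d
        ≈⟨ +-congʳ (*-cong
             (*-cong (reflexive (≡.cong ((- 1#) ^_) (toℕ-inject₁ k))) (e zero))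
             (det-cong λ i m → punchIn-swap (A (suc i)) k (e (suc i)) m)) ⟩
      (s * x) * d + (((- 1#) * s) * x) * d
        ≈⟨ solve 4 (λ m s x d → (s :* x) :* d :+ ((m :* s) :* x) :* d
             := (s :* x) :* d :+ m :* ((s :* x) :* d)) refl (- 1#) s x d ⟩
      (s * x) * d + (- 1#) * ((s * x) * d)  ≈⟨ +-congˡ (-1*x≈-x _) ⟩
      (s * x) * d - (s * x) * d             ≈⟨ -‿inverseʳ _ ⟩
      0#                                    ∎

  -- By linearity in column `suc k`, the change is `x` times the determinant of `C`, where that
  -- column is overwritten by its left neighbour, so that two adjacent columns agree.
  det-add-previous-column : ∀ {n} (A B : Matrix (suc n)) (k : Fin n) x →
    (∀ i j → j ≢ suc k → B i j ≈ A i j) →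
    (∀ i → B i (suc k) ≈ A i (suc k) + x * A i (inject₁ k)) → det B ≈ det A
  det-add-previous-column {n} A B k x B≈A Bₖ = begin
    det B              ≈⟨ det-linear-column A C B (suc k) x B≈A B≈C
                            (λ i → trans (Bₖ i) (+-congˡ (*-congˡ (sym (C-at i))))) ⟩
    det A + x * det C  ≈⟨ +-congˡ (trans (*-congˡ (det-equal-adjacent-columns C k C-equal)) (zeroʳ x)) ⟩
    det A + 0#         ≈⟨ +-identityʳ _ ⟩
    det A              ∎
    where
    C : Matrix (suc n)
    C i j with j Fin.≟ suc k
    ... | yes _ = A i (inject₁ k)
    ... | no  _ = A i j

    C-at : ∀ i → C i (suc k) ≈ A i (inject₁ k)
    C-at i with suc k Fin.≟ suc k
    ... | yes _   = refl
    ... | no  k≢k = ⊥-elim (k≢k ≡.refl)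

    C-off : ∀ i j → j ≢ suc k → C i j ≈ A i j
    C-off i j j≢ with j Fin.≟ suc k
    ... | yes p = ⊥-elim (j≢ p)
    ... | no  _ = refl

    B≈C : ∀ i j → j ≢ suc k → B i j ≈ C i j
    B≈C i j j≢ = trans (B≈A i j j≢) (sym (C-off i j j≢))

    k≢sk : ∀ {n} (k : Fin n) → inject₁ k ≢ suc k
    k≢sk zero    ()
    k≢sk (suc k) e = k≢sk k (Fin.suc-injective e)

    C-equal : ∀ i → C i (inject₁ k) ≈ C i (suc k)
    C-equal i = trans (C-off i (inject₁ k) (k≢sk k)) (sym (C-at i))

  private
    Columns : ℕ → ℕ → Set c
    Columns m n = Fin n → Fin m → Carrier

    -- Columns are changed from the last one down, so that the column added
    -- to each one is still the original.
    sweep : ∀ {m n} (D : Columns m (suc n) → Carrier) →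
      (∀ {v w} → (∀ j i → w j i ≈ v j i) → D w ≈ D v) →
      (∀ v w (k : Fin n) x → (∀ j → j ≢ suc k → ∀ i → w j i ≈ v j i) →
        (∀ i → w (suc k) i ≈ v (suc k) i + x * v (inject₁ k) i) → D w ≈ D v) →
      ∀ v w (x : Fin n → Carrier) → (∀ i → w zero i ≈ v zero i) →
      (∀ k i → w (suc k) i ≈ v (suc k) i + x k * v (inject₁ k) i) → D w ≈ D v
    sweep {n = zero}  D D-cong D-shear v w x w₀ wₛ = D-cong λ { zero i → w₀ i }
    sweep {n = suc n} D D-cong D-shear v w x w₀ wₛ = begin
      D w            ≈⟨ D-shear u w zero (x zero) off (λ i → wₛ zero i) ⟩
      -- Induction with column zero frozen: as a functional of the remaining columns, `D` keeps its
      -- congruence and its invariance under shears. For this reason `D` is arbitrary and not `det`.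
      D u            ≈⟨ sweep (λ t → D (v zero ∷ t))
                          (λ e → D-cong λ { zero i → refl ; (suc j) i → e j i })
                          (λ v′ w′ k y e f → D-shear (v zero ∷ v′) (w₀′ ∷ w′) (suc k) y
                            (λ { zero _ i → refl ; (suc j) j≢ i → e j (j≢ ∘ ≡.cong suc) i }) f)
                          (v ∘ suc) (u ∘ suc) (x ∘ suc) (λ i → refl) (λ k i → wₛ (suc k) i) ⟩
      D (v zero ∷ v ∘ suc)  ≈⟨ D-cong (λ { zero i → refl ; (suc j) i → refl }) ⟩
      D v            ∎
      where
      w₀′ = v zero
      -- Already swept from column two on; column one is still the original.
      u : Columns _ (suc (suc n))
      u = v zero ∷ v (suc zero) ∷ λ j → w (suc (suc j))
      off : ∀ j → j ≢ suc zero → ∀ i → w j i ≈ u j i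
      off zero          _ i = w₀ i
      off (suc zero)    p i = ⊥-elim (p ≡.refl)
      off (suc (suc j)) _ i = refl

  det-add-previous-columns : ∀ {n} (A B : Matrix (suc n)) (x : Fin n → Carrier) →
    (∀ i → B i zero ≈ A i zero) →
    (∀ i k → B i (suc k) ≈ A i (suc k) + x k * A i (inject₁ k)) → det B ≈ det A
  det-add-previous-columns A B x B₀ Bₛ = sweep (λ v → det λ i j → v j i)
    (λ e → det-cong λ i j → e j i)
    (λ v w k y e f → det-add-previous-column _ _ k y (λ i j j≢ → e j j≢ i) f)
    (λ j i → A i j) (λ j i → B i j) x B₀ (λ k i → Bₛ i k)

  det-zero-row : ∀ {n} (A : Matrix (suc n)) → (∀ j → A zero (suc j) ≈ 0#) →
    det A ≈ A zero zero * det (λ i j → A (suc i) (suc j))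
  det-zero-row {n} A A₀ = begin
    (1# * A zero zero) * d + sum (term A ∘ suc)
      ≈⟨ +-cong (*-congʳ (*-identityˡ _)) (trans
           (sum-cong (term A ∘ suc) (λ _ → 0#) λ j → trans (*-congʳ (trans (*-congˡ (A₀ j)) (zeroʳ _))) (zeroˡ _))
           (sum-replicate-zero n)) ⟩
    A zero zero * d + 0#  ≈⟨ +-identityʳ _ ⟩
    A zero zero * d       ∎
    where d = det (λ i j → A (suc i) (suc j))

-- The exponents of a and q.

-- n(n-1)/2 and n(n-1)(n-2)/3.
triangular : ℕ → ℕ
triangular zero    = 0
triangular (suc n) = triangular n ℕ.+ n

doubleTetrahedral : ℕ → ℕ
doubleTetrahedral zero    = 0
doubleTetrahedral (suc n) = doubleTetrahedral n ℕ.+ 2 ℕ.* triangular n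

triangular-suc : ∀ n → triangular (suc n) ℕ.* 2 ≡ suc n ℕ.* n
triangular-suc zero    = ≡.refl
triangular-suc (suc n) = ≡.trans
  (ℕ.*-distribʳ-+ 2 (triangular (suc n)) (suc n))
  (≡.trans (≡.cong (ℕ._+ suc n ℕ.* 2) (triangular-suc n))
    (solve 1 (λ n → (con 1 :+ n) :* n :+ (con 1 :+ n) :* con 2
      := (con 2 :+ n) :* (con 1 :+ n)) ≡.refl n))
  where open ℕ.+-*-Solver

-- Since k² = k(k-1) + k, the two sequences add up to the sum of k² for k ≤ n, and this is the
-- closed form of that sum. The factor 6 makes the later division exact.
doubleTetrahedral-suc : ∀ n →
  (doubleTetrahedral (suc n) ℕ.+ triangular (suc n)) ℕ.* 6 ≡ suc n ℕ.* n ℕ.* (2 ℕ.* suc n ℕ.∸ 1)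
doubleTetrahedral-suc zero    = ≡.refl
doubleTetrahedral-suc (suc n) = begin
  (S ℕ.+ 2 ℕ.* T ℕ.+ (T ℕ.+ suc n)) ℕ.* 6
    ≡⟨ solve 3 (λ S T n → (S :+ con 2 :* T :+ (T :+ (con 1 :+ n))) :* con 6
         := (S :+ T) :* con 6 :+ T :* con 2 :* con 6 :+ (con 1 :+ n) :* con 6) ≡.refl S T n ⟩
  (S ℕ.+ T) ℕ.* 6 ℕ.+ T ℕ.* 2 ℕ.* 6 ℕ.+ suc n ℕ.* 6
    ≡⟨ ≡.cong₂ (λ u v → u ℕ.+ v ℕ.* 6 ℕ.+ suc n ℕ.* 6) (doubleTetrahedral-suc n) (triangular-suc n) ⟩
  -- `n ℕ.+ suc (n ℕ.+ 0)` is what `2 ℕ.* suc n ℕ.∸ 1` computes to.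
  suc n ℕ.* n ℕ.* (n ℕ.+ suc (n ℕ.+ 0)) ℕ.+ suc n ℕ.* n ℕ.* 6 ℕ.+ suc n ℕ.* 6
    ≡⟨ solve 1 (λ n → (con 1 :+ n) :* n :* (n :+ (con 1 :+ (n :+ con 0)))
           :+ (con 1 :+ n) :* n :* con 6 :+ (con 1 :+ n) :* con 6
         := (con 2 :+ n) :* (con 1 :+ n) :* (con 1 :+ n :+ (con 2 :+ n :+ con 0))) ≡.refl n ⟩
  suc (suc n) ℕ.* suc n ℕ.* (suc n ℕ.+ suc (suc n ℕ.+ 0)) ∎
  where
  open ℕ.+-*-Solver
  open ≡.≡-Reasoning
  S = doubleTetrahedral (suc n)
  T = triangular (suc n)

triangular-/ : ∀ n → n ℕ.* (n ℕ.∸ 1) ℕ./ 2 ≡ triangular n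
triangular-/ zero    = ≡.refl
triangular-/ (suc n) = ≡.trans (≡.cong (ℕ._/ 2) (≡.sym (triangular-suc n))) (ℕ.m*n/n≡m _ 2)

-- The right side shows how the power of q arises: `(t ℕ.+ 1) ℕ.* triangular n` from the power of x
-- = aqᵗ⁺¹, and `doubleTetrahedral n` from the explicit power of q in the evaluation.
exponent-/ : ∀ n t →
  n ℕ.* (n ℕ.∸ 1) ℕ.* (2 ℕ.* n ℕ.∸ 1) ℕ./ 6 ℕ.+ n ℕ.* (n ℕ.∸ 1) ℕ.* t ℕ./ 2
    ≡ (t ℕ.+ 1) ℕ.* triangular n ℕ.+ doubleTetrahedral n
exponent-/ zero    t = ≡.sym (≡.trans (ℕ.+-identityʳ _) (ℕ.*-zeroʳ (t ℕ.+ 1)))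
exponent-/ (suc n) t = begin
  suc n ℕ.* n ℕ.* (2 ℕ.* suc n ℕ.∸ 1) ℕ./ 6 ℕ.+ suc n ℕ.* n ℕ.* t ℕ./ 2
    ≡⟨ ≡.cong₂ (λ u v → u ℕ./ 6 ℕ.+ v ℕ.* t ℕ./ 2) (doubleTetrahedral-suc n) (triangular-suc n) ⟨
  (S ℕ.+ T) ℕ.* 6 ℕ./ 6 ℕ.+ T ℕ.* 2 ℕ.* t ℕ./ 2
    ≡⟨ ≡.cong (λ u → (S ℕ.+ T) ℕ.* 6 ℕ./ 6 ℕ.+ u ℕ./ 2)
         (solve 2 (λ T t → T :* con 2 :* t := T :* t :* con 2) ≡.refl T t) ⟩
  (S ℕ.+ T) ℕ.* 6 ℕ./ 6 ℕ.+ T ℕ.* t ℕ.* 2 ℕ./ 2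
    ≡⟨ ≡.cong₂ ℕ._+_ (ℕ.m*n/n≡m (S ℕ.+ T) 6) (ℕ.m*n/n≡m (T ℕ.* t) 2) ⟩
  S ℕ.+ T ℕ.+ T ℕ.* t
    ≡⟨ solve 3 (λ S T t → S :+ T :+ T :* t := (t :+ con 1) :* T :+ S) ≡.refl S T t ⟩
  (t ℕ.+ 1) ℕ.* T ℕ.+ S ∎
  where
  open ℕ.+-*-Solver
  open ≡.≡-Reasoning
  S = doubleTetrahedral (suc n)
  T = triangular (suc n)

-- Hankel determinants of quotients of q-shifted factorials.

module QHankel {c ℓ : Level} (R : CommutativeRing c ℓ) (q : CommutativeRing.Carrier R) where
  open CommutativeRing R hiding (zero)
  open RingNotions R
  open Determinants R
  open SemiringExp semiring using (_^_; ^-homo-*; ^-congˡ)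
  open CommutativeSemiringExp commutativeSemiring using (^-distrib-*)
  open MonoidSum *-commutativeMonoid using ()
    renaming (sum to product; sum-cong-≋ to product-cong; ∑-distrib-+ to product-*;
              sum-replicate to product-replicate)
  open RingProperties ring using (-1*x≈-x; -‿distribˡ-*)
  open NaturalCoefficients commutativeSemiring using (solve; _:=_; _:+_; _:*_; con)
  open SetoidReasoning setoid

  shift : (ℕ → Carrier) → ℕ → Carrier
  shift f k = f (suc k)

  -- With sequences on ℕ in place of tuples, `∏ f (suc m)` unfolds to `f 0 * ∏ (shift f) m`, and
  -- replacing x by xq becomes a shift.
  ∏ : (ℕ → Carrier) → ℕ → Carrier
  ∏ f m = product {m} (f ∘ toℕ)

  ∏-cong : ∀ {f g} → (∀ k → f k ≈ g k) → ∀ m → ∏ f m ≈ ∏ g m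
  ∏-cong {f} {g} f≈g m = product-cong {x = f ∘ toℕ {m}} {y = g ∘ toℕ} (f≈g ∘ toℕ)

  ∏-* : ∀ f g m → ∏ (λ k → f k * g k) m ≈ ∏ f m * ∏ g m
  ∏-* f g m = product-* (f ∘ toℕ {m}) (g ∘ toℕ)

  ∏-const : ∀ x m → ∏ (λ _ → x) m ≈ x ^ m
  ∏-const x m = product-replicate m

  ∏-snoc : ∀ f m → ∏ f (suc m) ≈ ∏ f m * f m
  ∏-snoc f zero    = *-comm (f 0) 1#
  ∏-snoc f (suc m) = trans (*-congˡ (∏-snoc (shift f) m)) (sym (*-assoc _ _ _))

  ∏-+ : ∀ f m n → ∏ f (m ℕ.+ n) ≈ ∏ f m * ∏ (λ k → f (m ℕ.+ k)) n
  ∏-+ f zero    n = sym (*-identityˡ _)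
  ∏-+ f (suc m) n = trans (*-congˡ (∏-+ (shift f) m n)) (sym (*-assoc _ _ _))

  ∏-reverse : ∀ f n → ∏ (λ k → f (n ℕ.∸ suc k)) n ≈ ∏ f n
  ∏-reverse f zero    = refl
  ∏-reverse f (suc n) = trans (*-congˡ (∏-reverse f n)) (trans (*-comm _ _) (sym (∏-snoc f n)))

  ∏-1 : ∀ m → ∏ (λ _ → 1#) m ≈ 1#
  ∏-1 zero    = refl
  ∏-1 (suc m) = trans (*-identityˡ _) (∏-1 m)

  ∏-inverse : ∀ f g → (∀ k → f k * g k ≈ 1#) → ∀ m → ∏ f m * ∏ g m ≈ 1#
  ∏-inverse f g fg≈1 m = begin
    ∏ f m * ∏ g m            ≈⟨ ∏-* f g m ⟨
    ∏ (λ k → f k * g k) m    ≈⟨ ∏-cong fg≈1 m ⟩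
    ∏ (λ _ → 1#) m           ≈⟨ ∏-1 m ⟩
    1#                       ∎

  ∏-q^ : ∀ n → ∏ (q ^_) n ≈ q ^ triangular n
  ∏-q^ zero    = refl
  ∏-q^ (suc n) = begin
    ∏ (q ^_) (suc n)         ≈⟨ ∏-snoc (q ^_) n ⟩
    ∏ (q ^_) n * q ^ n       ≈⟨ *-congʳ (∏-q^ n) ⟩
    q ^ triangular n * q ^ n ≈⟨ ^-homo-* q (triangular n) n ⟨
    q ^ triangular (suc n)   ∎

  -- p k and r k stand for 1 - x qᵏ and 1 / (1 - y qᵏ).
  moment : (p r : ℕ → Carrier) → ℕ → Carrier
  moment p r m = ∏ p m * ∏ r m

  hankel : (p r : ℕ → Carrier) → ℕ → Carrier
  hankel p r n = det {n} λ i j → moment p r (toℕ i ℕ.+ toℕ j)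

  -- One step of column elimination; `y` stands here for the product called xy above.

  module _ (x y : Carrier) (p r : ℕ → Carrier)
           (p≈ : ∀ k → p k ≈ 1# - x * q ^ k) (r≈ : ∀ k → r k * (1# - y * q ^ k) ≈ 1#) where

    private
      e = - 1#

      1-≈ : ∀ z → 1# - z ≈ 1# + e * z
      1-≈ z = +-congˡ (sym (-1*x≈-x z))

      -- The semiring solver sees `e` as a free variable. The relation `1# + e ≈ 0#` therefore
      -- enters through multiples of `1# + e`, chosen to balance the two sides as polynomials in `e`
      -- and then dropped.
      expand : ∀ u z →
        (1# + e * (x * (u * z))) * (1# + e * (y * z)) + e * ((1# + e * (x * z)) * (1# + e * (y * (u * z))))
          ≈ z * (x + e * y) * (1# + e * u)
      expand u z = begin
        l                                                ≈⟨ +-identityʳ l ⟨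
        l + 0#                                           ≈⟨ +-congˡ (vanish _) ⟨
        l + (1# + e) * (x * z)
          ≈⟨ solve 5 (λ e u z x y →
               ((con 1 :+ e :* (x :* (u :* z))) :* (con 1 :+ e :* (y :* z))
                 :+ e :* ((con 1 :+ e :* (x :* z)) :* (con 1 :+ e :* (y :* (u :* z)))))
               :+ (con 1 :+ e) :* (x :* z)
               := z :* (x :+ e :* y) :* (con 1 :+ e :* u)
               :+ (con 1 :+ e) :* (con 1 :+ e :* e :* (x :* y :* u :* z :* z) :+ e :* (x :* z)))
               refl e u z x y ⟩
        z * (x + e * y) * (1# + e * u) + (1# + e) * (1# + e * e * (x * y * u * z * z) + e * (x * z))
          ≈⟨ +-congˡ (vanish _) ⟩
        z * (x + e * y) * (1# + e * u) + 0#              ≈⟨ +-identityʳ _ ⟩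
        z * (x + e * y) * (1# + e * u)                   ∎
        where
        l = (1# + e * (x * (u * z))) * (1# + e * (y * z)) + e * ((1# + e * (x * z)) * (1# + e * (y * (u * z))))
        vanish : ∀ w → (1# + e) * w ≈ 0#
        vanish w = trans (*-congʳ (-‿inverseʳ 1#)) (zeroˡ w)

      difference : ∀ i j →
        p (i ℕ.+ j) * r (i ℕ.+ j) - p j * r j
          ≈ r (i ℕ.+ j) * r j * (q ^ j * (x - y) * (1# - q ^ i))
      difference i j = begin
        p m * r m - p j * r j
          ≈⟨ +-cong (*-identityʳ _) (trans (-1*x≈-x _) (-‿cong (*-identityʳ _))) ⟨
        p m * r m * 1# + e * (p j * r j * 1#)
          -- Each 1 is written as a denominator times its inverse, which brings both quotients over
          -- the common denominator.
          ≈⟨ +-cong (*-congˡ (r≈ j)) (*-congˡ (*-congˡ (r≈ m))) ⟨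
        p m * r m * (r j * (1# - y * q ^ j)) + e * (p j * r j * (r m * (1# - y * q ^ m)))
          ≈⟨ solve 7 (λ e a b c d s t → a :* s :* (t :* b) :+ e :* (c :* t :* (s :* d))
               := s :* t :* (a :* b :+ e :* (c :* d)))
               refl e (p m) (1# - y * q ^ j) (p j) (1# - y * q ^ m) (r m) (r j) ⟩
        r m * r j * (p m * (1# - y * q ^ j) + e * (p j * (1# - y * q ^ m)))
          ≈⟨ *-congˡ (+-cong
               (*-cong (trans (p≈ m) (trans (1-≈ _) (+-congˡ (*-congˡ (*-congˡ qᵐ))))) (1-≈ _))
               (*-congˡ (*-cong (trans (p≈ j) (1-≈ _))
                 (trans (1-≈ _) (+-congˡ (*-congˡ (*-congˡ qᵐ))))))) ⟩
        r m * r j * ((1# + e * (x * (q ^ i * q ^ j))) * (1# + e * (y * q ^ j))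
                     + e * ((1# + e * (x * q ^ j)) * (1# + e * (y * (q ^ i * q ^ j)))))
          ≈⟨ *-congˡ (expand (q ^ i) (q ^ j)) ⟩
        r m * r j * (q ^ j * (x + e * y) * (1# + e * q ^ i))
          ≈⟨ *-congˡ (*-cong (*-congˡ (+-congˡ (-1*x≈-x y))) (sym (1-≈ _))) ⟩
        r m * r j * (q ^ j * (x - y) * (1# - q ^ i)) ∎
        where
        m = i ℕ.+ j
        qᵐ : q ^ m ≈ q ^ i * q ^ j
        qᵐ = ^-homo-* q i j

      -- The part of the entries of the remaining minor that depends on neither row nor column.
      κ = p 0 * (r 0 * r 1) * (x - y)

      M = moment p r

      M-suc : ∀ m → M (suc m) ≈ M m * (p m * r m)
      M-suc m = trans (*-cong (∏-snoc p m) (∏-snoc r m))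
        (solve 4 (λ a b c d → (a :* b) :* (c :* d) := (a :* c) :* (b :* d)) refl _ _ _ _)

      M-difference : ∀ i j →
        M (i ℕ.+ suc j) + - (p j * r j) * M (i ℕ.+ j)
          ≈ M (i ℕ.+ j) * (r (i ℕ.+ j) * r j * (q ^ j * (x - y) * (1# - q ^ i)))
      M-difference i j = begin
        M (i ℕ.+ suc j) + - (p j * r j) * M m
          ≈⟨ +-cong (trans (reflexive (≡.cong M (ℕ.+-suc i j))) (M-suc m)) (*-comm _ _) ⟩
        M m * (p m * r m) + M m * - (p j * r j)  ≈⟨ distribˡ _ _ _ ⟨
        M m * (p m * r m - p j * r j)            ≈⟨ *-congˡ (difference i j) ⟩
        M m * (r m * r j * (q ^ j * (x - y) * (1# - q ^ i))) ∎
        where m = i ℕ.+ j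

      M-difference-zero : ∀ j → M (suc j) + - (p j * r j) * M j ≈ 0#
      M-difference-zero j = begin
        M (suc j) + - (p j * r j) * M j            ≈⟨ +-congʳ (trans (M-suc j) (*-comm _ _)) ⟩
        p j * r j * M j + - (p j * r j) * M j      ≈⟨ +-congˡ (-‿distribˡ-* _ _) ⟨
        p j * r j * M j - p j * r j * M j          ≈⟨ -‿inverseʳ _ ⟩
        0#                                         ∎

      -- The extra `r m` lengthens the product over `r` by one factor, so two initial factors split
      -- off from it against one from the product over `p`. This is the passage from x, xy to xq,
      -- (xq)(yq).
      M-difference-suc : ∀ i j →
        M (suc i ℕ.+ suc j) + - (p j * r j) * M (suc i ℕ.+ j)
          ≈ (κ * (1# - q ^ suc i)) * (r j * q ^ j) * moment (shift p) (shift (shift r)) (i ℕ.+ j)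
      M-difference-suc i j = begin
        M (suc i ℕ.+ suc j) + - (p j * r j) * M m
          ≈⟨ M-difference (suc i) j ⟩
        (∏ p m * ∏ r m) * (r m * r j * (q ^ j * (x - y) * d))
          ≈⟨ solve 7 (λ P G s t z w d → (P :* G) :* (s :* t :* (z :* w :* d))
               := P :* (G :* s) :* (t :* (z :* w :* d))) refl _ _ _ _ _ _ _ ⟩
        ∏ p m * (∏ r m * r m) * (r j * (q ^ j * (x - y) * d))
          ≈⟨ *-congʳ (*-congˡ (∏-snoc r m)) ⟨
        (p 0 * ∏ (shift p) (i ℕ.+ j)) * (r 0 * (r 1 * ∏ (shift (shift r)) (i ℕ.+ j)))
          * (r j * (q ^ j * (x - y) * d))
          ≈⟨ solve 9 (λ a P b c G t z w d →
               (a :* P) :* (b :* (c :* G)) :* (t :* (z :* w :* d))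
               := ((a :* (b :* c) :* w) :* d) :* (t :* z) :* (P :* G)) refl _ _ _ _ _ _ _ _ _ ⟩
        (κ * d) * (r j * q ^ j) * moment (shift p) (shift (shift r)) (i ℕ.+ j) ∎
        where
        m = suc i ℕ.+ j
        d = 1# - q ^ suc i

    hankel-suc : ∀ n → hankel p r (suc n) ≈
      (p 0 * (r 0 * r 1) * (x - y)) ^ n * ∏ (λ i → 1# - q ^ suc i) n
        * (∏ r n * q ^ triangular n) * hankel (shift p) (shift (shift r)) n
    hankel-suc n = begin
      det A                                              ≈⟨ det-add-previous-columns A B _ (λ _ → refl) (λ _ _ → refl) ⟨
      det B                                              ≈⟨ det-zero-row B row₀ ⟩
      -- The corner entry is `M 0`, a product of two empty products.
      (1# * 1#) * det (λ i j → B (suc i) (suc j))        ≈⟨ trans (*-congʳ (*-identityˡ 1#)) (*-identityˡ _) ⟩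
      det (λ i j → B (suc i) (suc j))                    ≈⟨ det-cong entry ⟩
      det (λ i j → (κ * (1# - q ^ suc (toℕ i))) * (r (toℕ j) * q ^ toℕ j) * A′ i j)
        ≈⟨ det-scale _ _ A′ ⟩
      ∏ (λ i → κ * (1# - q ^ suc i)) n * ∏ (λ j → r j * q ^ j) n * det A′
        ≈⟨ *-congʳ (*-cong
             (trans (∏-* (λ _ → κ) (λ i → 1# - q ^ suc i) n) (*-congʳ (∏-const κ n)))
             (trans (∏-* r (q ^_) n) (*-congˡ (∏-q^ n)))) ⟩
      κ ^ n * ∏ (λ i → 1# - q ^ suc i) n * (∏ r n * q ^ triangular n) * det A′ ∎
      where
      A B : Matrix (suc n)
      A i j = M (toℕ i ℕ.+ toℕ j)
      B i zero    = A i zero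
      B i (suc j) = A i (suc j) + - (p (toℕ j) * r (toℕ j)) * A i (inject₁ j)

      A′ : Matrix n
      A′ i j = moment (shift p) (shift (shift r)) (toℕ i ℕ.+ toℕ j)

      previous : ∀ i (j : Fin n) → A i (inject₁ j) ≈ M (toℕ i ℕ.+ toℕ j)
      previous i j = reflexive (≡.cong (λ k → M (toℕ i ℕ.+ k)) (toℕ-inject₁ j))

      row₀ : ∀ j → B zero (suc j) ≈ 0#
      row₀ j = trans (+-congˡ (*-congˡ (previous zero j))) (M-difference-zero (toℕ j))

      entry : ∀ i j → B (suc i) (suc j)
        ≈ (κ * (1# - q ^ suc (toℕ i))) * (r (toℕ j) * q ^ toℕ j) * A′ i j
      entry i j = trans (+-congˡ (*-congˡ (previous (suc i) j))) (M-difference-suc (toℕ i) (toℕ j))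

  -- The product side and its recursion.

  -- With `p`, `b`, `s` as in `hankel-evaluation`, this is (x;q)ₘ (y;q)ₘ / ((xyqᵐ⁻¹;q)ₘ (xy;q)₂ₘ).
  -- The remaining (q;q)ₘ is kept apart because it does not change with x and y.
  factor : (p b s : ℕ → Carrier) → ℕ → Carrier
  factor p b s m = ∏ p m * ∏ b m * (∏ (λ k → s (m ℕ.+ k)) m * ∏ (shift s) (2 ℕ.* m))

  -- Matches `hankel-suc`: over all m < n, the part of the prefactor independent of m gives the n-th
  -- power, up to xⁿ, and `s (suc m)` gives the product of the column factors.
  factor-suc : ∀ p b s m → factor p b s (suc m)
    ≈ p 0 * (s 1 * s 2) * b 0 * s (suc m) * factor (shift p) (shift b) (shift (shift s)) m
  factor-suc p b s m = begin
    (p 0 * P) * (b 0 * B) * ((s (suc m ℕ.+ 0) * ∏ (λ k → s (suc m ℕ.+ suc k)) m) * ∏ (shift s) (2 ℕ.* suc m))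
      ≈⟨ *-congˡ (*-cong
           (*-cong (reflexive (≡.cong s (ℕ.+-identityʳ (suc m))))
                   (∏-cong (λ k → reflexive (≡.cong (shift s) (ℕ.+-suc m k))) m))
           (reflexive (≡.cong (∏ (shift s)) (ℕ.*-suc 2 m)))) ⟩
    (p 0 * P) * (b 0 * B) * ((s (suc m) * S) * (s 1 * (s 2 * S′)))
      ≈⟨ solve 9 (λ p P b B u S v w S′ → (p :* P) :* (b :* B) :* ((u :* S) :* (v :* (w :* S′)))
           := p :* (v :* w) :* b :* u :* (P :* B :* (S :* S′))) refl _ _ _ _ _ _ _ _ _ ⟩
    p 0 * (s 1 * s 2) * b 0 * s (suc m) * (P * B * (S * S′)) ∎
    where
    P  = ∏ (shift p) m
    B  = ∏ (shift b) m
    S  = ∏ (λ k → s (suc (suc (m ℕ.+ k)))) m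
    S′ = ∏ (shift (shift (shift s))) (2 ℕ.* m)

  -- s (suc k) stands for 1 / (1 - x y qᵏ): the shift by one accommodates the
  -- factors (xy/q) qᵐ⁺ᵏ; s 0 only occurs inside empty products.
  hankel-evaluation : ∀ n x y (p b s : ℕ → Carrier) →
    (∀ k → p k ≈ 1# - x * q ^ k) → (∀ k → b k ≈ 1# - y * q ^ k) →
    (∀ k → s (suc k) * (1# - x * y * q ^ k) ≈ 1#) →
    hankel p (shift s) n ≈
      x ^ triangular n * q ^ doubleTetrahedral n
        * ∏ (λ m → ∏ (λ k → 1# - q ^ suc k) m * factor p b s m) n
  hankel-evaluation zero    x y p b s p≈ b≈ s≈ = sym (trans (*-congʳ (*-identityˡ 1#)) (*-identityˡ 1#))
  hankel-evaluation (suc n) x y p b s p≈ b≈ s≈ = begin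
    hankel p (shift s) (suc n)
      ≈⟨ hankel-suc x (x * y) p (shift s) p≈ s≈ n ⟩
    (p 0 * (s 1 * s 2) * (x - x * y)) ^ n * φ n * (∏ (shift s) n * q ^ T) * hankel (shift p) (shift (shift (shift s))) n
      ≈⟨ *-cong (*-congʳ (*-congʳ κⁿ)) ih ⟩
    (x ^ n * κ ^ n) * φ n * (∏ (shift s) n * q ^ T) * ((x ^ T * q ^ T) * q ^ S * (∏ φ n * ∏ f′ n))
      -- The units introduced are the `q ^ 0` from unfolding `2 ℕ.* T` and the factor `f 0`.
      ≈⟨ solve 9 (λ xn kn cn sn qT xT qS C F →
           (xn :* kn) :* cn :* (sn :* qT) :* ((xT :* qT) :* qS :* (C :* F))
           := (xT :* xn) :* (qS :* (qT :* (qT :* con 1))) :* ((C :* cn) :* (con 1 :* (kn :* sn :* F))))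
           refl _ _ _ _ _ _ _ _ _ ⟩
    (x ^ T * x ^ n) * (q ^ S * (q ^ T * (q ^ T * 1#))) * ((∏ φ n * φ n) * (1# * (κ ^ n * ∏ (shift s) n * ∏ f′ n)))
      -- The product of `φ` loses its last factor and that of `f` its first, since the recursion
      -- shifts only `f`.
      ≈⟨ *-cong (*-cong (^-homo-* x T n) qˢ) (*-cong (∏-snoc φ n) (*-cong f₀ fₛ)) ⟨
    x ^ triangular (suc n) * q ^ doubleTetrahedral (suc n) * (∏ φ (suc n) * ∏ f (suc n))
      ≈⟨ *-congˡ (∏-* φ f (suc n)) ⟨
    x ^ triangular (suc n) * q ^ doubleTetrahedral (suc n) * ∏ (λ m → φ m * f m) (suc n) ∎
    where
    T = triangular n
    S = doubleTetrahedral n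
    κ = p 0 * (s 1 * s 2) * b 0
    φ : ℕ → Carrier
    φ = ∏ (λ k → 1# - q ^ suc k)
    f = factor p b s
    f′ = factor (shift p) (shift b) (shift (shift s))

    *q-*q^ : ∀ z k → z * q * q ^ k ≈ z * q ^ suc k
    *q-*q^ z k = *-assoc z q (q ^ k)

    ih : hankel (shift p) (shift (shift (shift s))) n
       ≈ (x ^ T * q ^ T) * q ^ S * (∏ φ n * ∏ f′ n)
    ih = trans
      (hankel-evaluation n (x * q) (y * q) (shift p) (shift b) (shift (shift s))
        (λ k → trans (p≈ (suc k)) (+-congˡ (-‿cong (sym (*q-*q^ x k)))))
        (λ k → trans (b≈ (suc k)) (+-congˡ (-‿cong (sym (*q-*q^ y k)))))
        (λ k → trans (*-congˡ (+-congˡ (-‿cong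
          (solve 4 (λ x y q z → (x :* q) :* (y :* q) :* z := x :* y :* (q :* (q :* z))) refl x y q (q ^ k)))))
          (s≈ (suc (suc k)))))
      (*-cong (*-congʳ (^-distrib-* x q T)) (∏-* φ f′ n))

    x-xy : x - x * y ≈ x * b 0
    x-xy = begin
      x - x * y               ≈⟨ +-cong (*-identityʳ x) (-1*x≈-x _) ⟨
      x * 1# + - 1# * (x * y) ≈⟨ solve 3 (λ e x y → x :* con 1 :+ e :* (x :* y) := x :* (con 1 :+ e :* (y :* con 1))) refl (- 1#) x y ⟩
      x * (1# + - 1# * (y * 1#)) ≈⟨ *-congˡ (+-congˡ (-1*x≈-x _)) ⟩
      x * (1# - y * 1#)       ≈⟨ *-congˡ (b≈ 0) ⟨
      x * b 0                 ∎

    κⁿ : (p 0 * (s 1 * s 2) * (x - x * y)) ^ n ≈ x ^ n * κ ^ n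
    κⁿ = trans (^-congˡ n (trans (*-congˡ x-xy)
           (solve 3 (λ u x b → u :* (x :* b) := x :* (u :* b)) refl _ _ _)))
         (^-distrib-* x κ n)

    -- One `q ^ T` comes from the column factors, the other from `(x * q) ^ T`.
    qˢ : q ^ doubleTetrahedral (suc n) ≈ q ^ S * (q ^ T * (q ^ T * 1#))
    qˢ = trans (^-homo-* q S (2 ℕ.* T)) (*-congˡ (trans (^-homo-* q T (T ℕ.+ 0)) (*-congˡ (^-homo-* q T 0))))

    f₀ : f 0 ≈ 1#
    f₀ = trans (*-cong (*-identityˡ 1#) (*-identityˡ 1#)) (*-identityˡ 1#)

    fₛ : ∏ (shift f) n ≈ κ ^ n * ∏ (shift s) n * ∏ f′ n
    fₛ = begin
      ∏ (shift f) n                          ≈⟨ ∏-cong (factor-suc p b s) n ⟩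
      ∏ (λ m → κ * s (suc m) * f′ m) n       ≈⟨ ∏-* (λ m → κ * s (suc m)) f′ n ⟩
      ∏ (λ m → κ * s (suc m)) n * ∏ f′ n     ≈⟨ *-congʳ (trans (∏-* (λ _ → κ) (shift s) n) (*-congʳ (∏-const κ n))) ⟩
      κ ^ n * ∏ (shift s) n * ∏ f′ n         ∎

-- Specialization to x = aqᵗ⁺¹ and y = bq.

module _ where
  open ℕ.+-*-Solver

  2+[t+k]≡t+1+[1+k] : ∀ t k → 2 ℕ.+ (t ℕ.+ k) ≡ t ℕ.+ 1 ℕ.+ suc k
  2+[t+k]≡t+1+[1+k] = solve 2 (λ t k →
    con 2 :+ (t :+ k) := t :+ con 1 :+ (con 1 :+ k)) ≡.refl

  t+2+k≡t+1+[1+k] : ∀ t k → t ℕ.+ 2 ℕ.+ k ≡ t ℕ.+ 1 ℕ.+ suc k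
  t+2+k≡t+1+[1+k] = solve 2 (λ t k →
    t :+ con 2 :+ k := t :+ con 1 :+ (con 1 :+ k)) ≡.refl

  m+t+1+k≡t+1+[m+k] : ∀ m t k → m ℕ.+ t ℕ.+ 1 ℕ.+ k ≡ t ℕ.+ 1 ℕ.+ (m ℕ.+ k)
  m+t+1+k≡t+1+[m+k] = solve 3 (λ m t k →
    m :+ t :+ con 1 :+ k := t :+ con 1 :+ (m :+ k)) ≡.refl

module LittleQJacobi {c ℓ : Level} (R : CommutativeRing c ℓ)
  (a b q : CommutativeRing.Carrier R)
  (inverse : CommutativeRing.Carrier R → CommutativeRing.Carrier R)
  where
  open CommutativeRing R hiding (zero)
  open RingNotions R
  open Determinants R
  open QHankel R q
  open SemiringExp semiring using (_^_; ^-homo-*; ^-congʳ; ^-assocʳ)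
  open CommutativeSemiringExp commutativeSemiring using (^-distrib-*)
  open NaturalCoefficients commutativeSemiring using (solve; _:=_; _:+_; _:*_; con)
  open SetoidReasoning setoid

  -- Uniqueness identifies the inverse of a product with the product of the inverses of its factors
  -- 1 - abqᵉ, the elements assumed invertible.
  module _
    (inverse-unique : ∀ x z → x * z ≈ 1# → inverse x ≈ z)
    (invertible : ∀ e → (1# - a * b * q ^ e) * inverse (1# - a * b * q ^ e) ≈ 1#)
    where

    private
      -- Becomes `μ` by definition once `inverse` is the field inverse.
      weight : ℕ → Carrier
      weight m = ⟨ a * q ⨾ q ⟩ m * inverse (⟨ a * b * q ^ 2 ⨾ q ⟩ m)

      module _ (t : ℕ) where

        -- The offset t + 1 in `s` makes `shift s` the inverses of 1 - xyqᵏ, where xy = abqᵗ⁺².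
        p β s : ℕ → Carrier
        p k = 1# - a * q ^ (t ℕ.+ 1) * q ^ k
        β k = 1# - b * q * q ^ k
        s k = inverse (1# - a * b * q ^ (t ℕ.+ 1 ℕ.+ k))

        s-inverse : ∀ k {x} → x ≈ a * b * q ^ (t ℕ.+ 1 ℕ.+ k) → (1# - x) * s k ≈ 1#
        s-inverse k x≈ = trans (*-congʳ (+-congˡ (-‿cong x≈))) (invertible (t ℕ.+ 1 ℕ.+ k))

        merge : ∀ e j k → e ℕ.+ j ≡ k → a * b * q ^ e * q ^ j ≈ a * b * q ^ k
        merge e j k e+j≡k = trans (*-assoc _ _ _)
          (*-congˡ (trans (sym (^-homo-* q e j)) (^-congʳ q e+j≡k)))

        -- Serves both denominators of `ratio`: `d` is `m` for the first and 1 for the second.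
        ∏s-inverse : ∀ e d m → (∀ k → e ℕ.+ k ≡ t ℕ.+ 1 ℕ.+ (d ℕ.+ k)) →
          ⟨ a * b * q ^ e ⨾ q ⟩ m * ∏ (λ k → s (d ℕ.+ k)) m ≈ 1#
        ∏s-inverse e d m e≡ = ∏-inverse (λ k → 1# - a * b * q ^ e * q ^ k) (λ k → s (d ℕ.+ k))
          (λ k → s-inverse (d ℕ.+ k) (merge e k _ (e≡ k))) m

        product-inverse : ∀ {x y u v} → x * u ≈ 1# → y * v ≈ 1# → (x * y) * (u * v) ≈ 1#
        product-inverse {x} {y} {u} {v} xu≈1 yv≈1 = begin
          (x * y) * (u * v)  ≈⟨ solve 4 (λ x y u v → (x :* y) :* (u :* v) := (x :* u) :* (y :* v)) refl x y u v ⟩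
          (x * u) * (y * v)  ≈⟨ *-cong xu≈1 yv≈1 ⟩
          1# * 1#            ≈⟨ *-identityˡ 1# ⟩
          1#                 ∎

        denominator-inverse : ∀ m →
          ⟨ a * b * q ^ 2 ⨾ q ⟩ m * inverse (⟨ a * b * q ^ 2 ⨾ q ⟩ m) ≈ 1#
        denominator-inverse m = trans (*-congˡ (inverse-unique _ _ d≈1)) d≈1
          where
          d≈1 : ⟨ a * b * q ^ 2 ⨾ q ⟩ m * ∏ (λ k → inverse (1# - a * b * q ^ (2 ℕ.+ k))) m ≈ 1#
          d≈1 = ∏-inverse (λ k → 1# - a * b * q ^ 2 * q ^ k) _
            (λ k → trans (*-congʳ (+-congˡ (-‿cong (merge 2 k _ ≡.refl)))) (invertible (2 ℕ.+ k))) m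

        -- Both factorials of length t + m split after t factors, and the tails start at aqᵗ⁺¹ and
        -- abqᵗ⁺².
        weight-+ : ∀ m → weight (m ℕ.+ t) ≈ weight t * moment p (shift s) m
        weight-+ m = begin
          weight (m ℕ.+ t)  ≈⟨ reflexive (≡.cong weight (ℕ.+-comm m t)) ⟩
          weight (t ℕ.+ m)  ≈⟨ *-cong num (inverse-unique _ _ den) ⟩
          (⟨ a * q ⨾ q ⟩ t * ∏ p m) * (inverse (⟨ a * b * q ^ 2 ⨾ q ⟩ t) * ∏ (shift s) m)
            ≈⟨ solve 4 (λ x y u v → (x :* y) :* (u :* v) := (x :* u) :* (y :* v)) refl _ _ _ _ ⟩
          weight t * moment p (shift s) m ∎
          where
          num : ⟨ a * q ⨾ q ⟩ (t ℕ.+ m) ≈ ⟨ a * q ⨾ q ⟩ t * ∏ p m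
          num = trans (∏-+ (λ k → 1# - a * q * q ^ k) t m)
            (*-congˡ (∏-cong (λ k → +-congˡ (-‿cong (begin
              a * q * q ^ (t ℕ.+ k)       ≈⟨ *-congˡ (^-homo-* q t k) ⟩
              a * q * (q ^ t * q ^ k)
                ≈⟨ solve 4 (λ a q u v → a :* q :* (u :* v) := a :* (u :* (q :* con 1)) :* v) refl a q _ _ ⟩
              a * (q ^ t * (q * 1#)) * q ^ k
                ≈⟨ *-congʳ (*-congˡ (^-homo-* q t 1)) ⟨
              a * q ^ (t ℕ.+ 1) * q ^ k   ∎))) m))

          h : ℕ → Carrier
          h k = 1# - a * b * q ^ 2 * q ^ k

          den : ⟨ a * b * q ^ 2 ⨾ q ⟩ (t ℕ.+ m) * (inverse (⟨ a * b * q ^ 2 ⨾ q ⟩ t) * ∏ (shift s) m) ≈ 1#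
          den = trans (*-congʳ (∏-+ h t m))
            (product-inverse (denominator-inverse t)
              (∏-inverse (λ k → h (t ℕ.+ k)) (shift s) (λ k → s-inverse (suc k)
                (merge 2 (t ℕ.+ k) _ (2+[t+k]≡t+1+[1+k] t k))) m))

        ratio : ℕ → Carrier
        ratio m = (⟨ q ⨾ q ⟩ m * ⟨ a * q ^ (t ℕ.+ 1) ⨾ q ⟩ m * ⟨ b * q ⨾ q ⟩ m)
          * inverse (⟨ a * b * q ^ (m ℕ.+ t ℕ.+ 1) ⨾ q ⟩ m * ⟨ a * b * q ^ (t ℕ.+ 2) ⨾ q ⟩ (2 ℕ.* m))

        ratio-factor : ∀ m → ∏ (λ k → 1# - q ^ suc k) m * factor p β s m ≈ ratio m
        ratio-factor m = begin
          ∏ (λ k → 1# - q ^ suc k) m * factor p β s m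
            -- The first product is already (q;q)ₘ, since `q ^ suc k` unfolds to `q * q ^ k`.
            ≈⟨ solve 4 (λ x y z w → x :* (y :* z :* w) := x :* y :* z :* w) refl _ _ _ _ ⟩
          (⟨ q ⨾ q ⟩ m * ⟨ a * q ^ (t ℕ.+ 1) ⨾ q ⟩ m * ⟨ b * q ⨾ q ⟩ m)
            * (∏ (λ k → s (m ℕ.+ k)) m * ∏ (shift s) (2 ℕ.* m))
            ≈⟨ *-congˡ (inverse-unique _ _ (product-inverse
                 (∏s-inverse (m ℕ.+ t ℕ.+ 1) m m (m+t+1+k≡t+1+[m+k] m t))
                 (∏s-inverse (t ℕ.+ 2) 1 (2 ℕ.* m) (t+2+k≡t+1+[1+k] t)))) ⟨
          ratio m ∎

        s-inverse′ : ∀ k → s (suc k) * (1# - a * q ^ (t ℕ.+ 1) * (b * q) * q ^ k) ≈ 1#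
        s-inverse′ k = trans (*-comm _ _) (s-inverse (suc k) (begin
          a * q ^ (t ℕ.+ 1) * (b * q) * q ^ k
            ≈⟨ solve 5 (λ a u b q v → a :* u :* (b :* q) :* v := a :* b :* u :* (q :* v)) refl a _ b q _ ⟩
          a * b * q ^ (t ℕ.+ 1) * q ^ suc k     ≈⟨ merge (t ℕ.+ 1) (suc k) _ ≡.refl ⟩
          a * b * q ^ (t ℕ.+ 1 ℕ.+ suc k)       ∎))

    weight-hankel : ∀ n t →
      det {n} (λ i j → weight (toℕ i ℕ.+ toℕ j ℕ.+ t)) ≈
        a ^ (n ℕ.* (n ℕ.∸ 1) ℕ./ 2)
        * q ^ (n ℕ.* (n ℕ.∸ 1) ℕ.* (2 ℕ.* n ℕ.∸ 1) ℕ./ 6 ℕ.+ n ℕ.* (n ℕ.∸ 1) ℕ.* t ℕ./ 2)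
        * weight t ^ n * ∏[1≤k≤ n ] (λ k → ratio t (n ℕ.∸ k))
    weight-hankel n t = begin
      det {n} (λ i j → weight (toℕ i ℕ.+ toℕ j ℕ.+ t))
        -- `1#` is inserted as a trivial column factor for `det-scale`; the rows carry `weight t`.
        ≈⟨ det-cong {n} (λ i j → trans (weight-+ t (toℕ i ℕ.+ toℕ j)) (*-congʳ (sym (*-identityʳ _)))) ⟩
      det {n} (λ i j → (weight t * 1#) * moment (p t) (shift (s t)) (toℕ i ℕ.+ toℕ j))
        ≈⟨ det-scale {n} (λ _ → weight t) (λ _ → 1#) (λ i j → moment (p t) (shift (s t)) (toℕ i ℕ.+ toℕ j)) ⟩
      ∏ (λ _ → weight t) n * ∏ (λ _ → 1#) n * hankel (p t) (shift (s t)) n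
        ≈⟨ *-cong (trans (*-cong (∏-const (weight t) n) (∏-1 n)) (*-identityʳ _))
             (hankel-evaluation n (a * q ^ (t ℕ.+ 1)) (b * q) (p t) (β t) (s t)
               (λ _ → refl) (λ _ → refl) (s-inverse′ t)) ⟩
      weight t ^ n * ((a * q ^ (t ℕ.+ 1)) ^ T * q ^ S
        * ∏ (λ m → ∏ (λ k → 1# - q ^ suc k) m * factor (p t) (β t) (s t) m) n)
        -- The evaluation runs over m from 0 to n - 1, the theorem over k with m = n - k; hence the
        -- reversal.
        ≈⟨ *-congˡ (*-cong (*-congʳ (^-distrib-* a _ T))
             (trans (∏-cong (ratio-factor t) n) (sym (∏-reverse (ratio t) n)))) ⟩
      weight t ^ n * (a ^ T * (q ^ (t ℕ.+ 1)) ^ T * q ^ S * ∏ᵣ)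
        ≈⟨ solve 5 (λ w x y z r → w :* (x :* y :* z :* r) := x :* (y :* z) :* w :* r) refl _ _ _ _ _ ⟩
      a ^ T * ((q ^ (t ℕ.+ 1)) ^ T * q ^ S) * weight t ^ n * ∏ᵣ
        ≈⟨ *-congʳ (*-congʳ (*-cong (^-congʳ a (triangular-/ n)) (begin
             q ^ (n ℕ.* (n ℕ.∸ 1) ℕ.* (2 ℕ.* n ℕ.∸ 1) ℕ./ 6 ℕ.+ n ℕ.* (n ℕ.∸ 1) ℕ.* t ℕ./ 2)
               ≈⟨ ^-congʳ q (exponent-/ n t) ⟩
             q ^ ((t ℕ.+ 1) ℕ.* T ℕ.+ S)          ≈⟨ ^-homo-* q ((t ℕ.+ 1) ℕ.* T) S ⟩
             q ^ ((t ℕ.+ 1) ℕ.* T) * q ^ S        ≈⟨ *-congʳ (^-assocʳ q (t ℕ.+ 1) T) ⟨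
             (q ^ (t ℕ.+ 1)) ^ T * q ^ S          ∎))) ⟨
      a ^ (n ℕ.* (n ℕ.∸ 1) ℕ./ 2)
        * q ^ (n ℕ.* (n ℕ.∸ 1) ℕ.* (2 ℕ.* n ℕ.∸ 1) ℕ./ 6 ℕ.+ n ℕ.* (n ℕ.∸ 1) ℕ.* t ℕ./ 2)
        * weight t ^ n * ∏ᵣ ∎
      where
      T = triangular n
      S = doubleTetrahedral n
      ∏ᵣ = ∏ (λ k → ratio t (n ℕ.∸ suc k)) n

-- The field ℚ(a,b,q).

open import Defs
open Nonvanishing using (denominator≉0)

private
  module F = CommutativeRing ℚ⟨a,b,q⟩

⁻¹-unique : ∀ x z → x * z ≈ 1# → x ⁻¹ ≈ z
⁻¹-unique x z xz≈1 = begin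
  x ⁻¹            ≈⟨ F.*-identityʳ (x ⁻¹) ⟨
  x ⁻¹ * 1#       ≈⟨ F.*-congˡ {x ⁻¹} xz≈1 ⟨
  x ⁻¹ * (x * z)  ≈⟨ F.*-assoc (x ⁻¹) x z ⟨
  x ⁻¹ * x * z    ≈⟨ F.*-congʳ {z} (F.trans (F.*-comm (x ⁻¹) x) (⁻¹ᶠ-inverseʳ x x≉0)) ⟩
  1# * z          ≈⟨ F.*-identityˡ z ⟩
  z               ∎
  where
  open SetoidReasoning F.setoid
  x≉0 : ¬ x ≈ 0#
  x≉0 x≈0 = denominator≉0 0 0
    -- `denominator≉0 0 0` concerns an empty product, so it says that 1 is not 0, whereas x = 0
    -- would give 1 = xz = 0.
    (F.trans (F.sym xz≈1) (F.trans (F.*-congʳ {z} x≈0) (F.zeroˡ z)))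

1-abqᵉ-invertible : ∀ e → (1# - a * b * q ^ e) * (1# - a * b * q ^ e) ⁻¹ ≈ 1#
-- The factorial of length 1 is the single factor 1 - abqᵉ up to units, which the chain removes.
1-abqᵉ-invertible e = ⁻¹ᶠ-inverseʳ (1# - a * b * q ^ e) λ z → denominator≉0 e 1 (begin
  (1# - a * b * q ^ e * 1#) * 1#  ≈⟨ F.*-identityʳ _ ⟩
  1# - a * b * q ^ e * 1#         ≈⟨ F.+-congˡ {1#} (F.-‿cong (F.*-identityʳ (a * b * q ^ e))) ⟩
  1# - a * b * q ^ e              ≈⟨ z ⟩
  0#                              ∎)
  where open SetoidReasoning F.setoid

corollary1p2 : (n t : ℕ) .{{_ : NonZero n}} →
    det {n} (λ i j → μ (toℕ i ℕ.+ toℕ j ℕ.+ t))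
      ≈ a ^ (n ℕ.* (n ℕ.∸ 1) ℕ./ 2)
        * q ^ (n ℕ.* (n ℕ.∸ 1) ℕ.* (2 ℕ.* n ℕ.∸ 1) ℕ./ 6 ℕ.+ n ℕ.* (n ℕ.∸ 1) ℕ.* t ℕ./ 2)
        * (⟨ a * q ⨾ q ⟩ t / ⟨ a * b * q ^ 2 ⨾ q ⟩ t) ^ n
        * ∏[1≤k≤ n ] (λ k →
            (⟨ q ⨾ q ⟩ (n ℕ.∸ k) * ⟨ a * q ^ (t ℕ.+ 1) ⨾ q ⟩ (n ℕ.∸ k) * ⟨ b * q ⨾ q ⟩ (n ℕ.∸ k))
            / (⟨ a * b * q ^ (n ℕ.∸ k ℕ.+ t ℕ.+ 1) ⨾ q ⟩ (n ℕ.∸ k)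
               * ⟨ a * b * q ^ (t ℕ.+ 2) ⨾ q ⟩ (2 ℕ.* (n ℕ.∸ k))))
corollary1p2 n t =
  LittleQJacobi.weight-hankel ℚ⟨a,b,q⟩ a b q _⁻¹ ⁻¹-unique 1-abqᵉ-invertible n t
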